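{- Let $\mathcal A$ be a class of function algebras. The class of provably total functions of the recursive arithmetic $\mathcal A\mathsf{RA}_1$ is exactly the class of functions $f\colon\mathbb N\times 2^{\mathbb N}\to\mathbb N$ for which there is a derivation $d$ in $\mathcal A$ such that for every $X\subseteq\mathbb N$ the standard model $(\mathbb N,X,\vec f)$ of $\mathcal A\mathsf{RA}_1$ satisfies $f_d(x)=f(x,X)$ for all $x\in\mathbb N$.
   Context: **Language $L_1$ and BASIC.** $L_1$ is the first-order language with constant $0$, unary function symbols $S,H,T$, binary function symbols $+,\cdot$, a binary pairing function symbol $(\cdot,\cdot)$, and a binary relation $<$. Write $1=S(0)$, $2=S(S(0))$, and $x\le y$ for $x<y\lor x=y$. Pairing associates to the right, and $f(x,y)$ means $f((x,y))$. BASIC consists of the universal closures of: $S(x)\neq 0$; $S(x)=S(y)\to x=y$; $x+0=x$; $x+S(y)=S(x+y)$; $x\cdot 0=0$; $x\cdot S(y)=x\cdot y+x$; $\lnot x<0$; $x<S(y)\leftrightarrow x<y\lor x=y$; $x<y\lor x=y\lor y<x$; $0<x\to\exists y<x\,S(y)=x$; $(x,y)=z\leftrightarrow 2\cdot z=(x+y)\cdot(x+y+1)+2\cdot x+2$; $(x,y)=(x',y')\to x=x'\land y=y'$; $z>0\to\exists x,y<z\,(x,y)=z$; $H((x,y))=x$; $H(0)=0$; $T((x,y))=y$; $T(0)=0$. $\mathbb N$ also denotes the standard $L_1$-structure satisfying BASIC. **Functions as sets.** $L_1(X,\vec f)$ is $L_1$ with additional unary predicate symbols ("set constants") $X$ and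 $f_d$ ($d$ a derivation, below); $t\in X$ is written for $X(t)$. For a set $f$, $f\in\mathcal F$ abbreviates $\forall x\exists y\,(x,y)\in f\land\forall x,y,y'((x,y)\in f\land(x,y')\in f\to y=y')\land 0\notin f$; $f(t)=s$ abbreviates $(t,s)\in f$. **Function operators and classes of algebras.** A function operator $f:=\mathrm{op}(g_1,\dots,g_n)$ ($n\ge 0$) is specified by a formula of $L_1$ extended with atomic formulas $t\in Y$ for set variables $Y$, with no free number variables and no set quantifiers, containing exactly the set variables $f,g_1,\dots,g_n$, and which is a universal sentence (the universal closure over number variables of a quantifier-free formula, with $g(t)=s$ read as $(t,s)\in g$). It is required that for all $X\subseteq\mathbb N$ and all $g_1,\dots,g_n\subseteq\mathbb N$ in $\mathcal F$ there is a unique $f\subseteq\mathbb N$ satisfying $f:=\mathrm{op}(g_1,\dots,g_n)$ and $f\in\mathcal F$. Used with set constants in place of set variables, such an operator is a schema. The oracle operator $f:=X_\ast$ is $\forall x((x\in X\to f(x)=1)\land(x\notin X\to f(x)=0))$. A class of function algebras $\mathcal A$ is given by a finite tuple of function operators; it is required throughout that this tuple contains the following operators, each the universal closure of the displayed formula: - $f:=\mathrm S$: $f(x)=S(x)$; - $f:=\oplus$: $f(x,y)=x+y\land f(0)=0$; - $f:=\otimes$: $f(x,y)=x\cdot y\land f(0)=0$; - $f:={<_\ast}$: $(x<y\to f(x,y)=1)\land(x\ge y\to f(x,y)=0)\land f(0)=0$; - $f:=\mathrm I$: $f(x)=x$; - $f:=\mathrm D$: $f(0,y,z)=y\land f(S(x),y,z)=z\land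 f(0)=0\land f(x,0)=0$; - $f:=\mathrm P(g,h)$: $g(x)=v\land h(x)=w\to f(x)=(v,w)$; - $f:=g\circ h$: $h(x)=z\land g(z)=y\to f(x)=y$; - $f:=\mu(g)$: $(f(b,x)=z\to z\le b)\land(f(b,x)=z\land y<b\land g(y,x)=1\to z\le y)\land(f(b,x)=z\land z<b\to g(z,x)=1)\land f(0)=0$. **Derivations, $\mathcal A\mathsf{RA}_1$, standard models.** Derivations in $\mathcal A$ are the least set of formal terms containing the symbol $X_\ast$ and containing $\mathrm{op}(d_1,\dots,d_n)$ for each $n$-ary operator $\mathrm{op}$ of $\mathcal A$ and derivations $d_1,\dots,d_n$. The recursive arithmetic $\mathcal A\mathsf{RA}_1$ is the theory in $L_1(X,\vec f)$ consisting of BASIC, the axioms $f_{X_\ast}:=X_\ast$ and $f_{X_\ast}\in\mathcal F$, and for each operator and derivations $d_1,\dots,d_n$ the axioms $f_{\mathrm{op}(d_1,\dots,d_n)}:=\mathrm{op}(f_{d_1},\dots,f_{d_n})$ and $f_{\mathrm{op}(d_1,\dots,d_n)}\in\mathcal F$. For each $X\subseteq\mathbb N$ the structure $(\mathbb N,X)$ expands uniquely to a model $(\mathbb N,X,\vec f)$ of $\mathcal A\mathsf{RA}_1$, called a standard model. **Provably total functions.** A provably total function of $\mathcal A\mathsf{RA}_1$ is a function $f\colon\mathbb N\times 2^{\mathbb N}\to\mathbb N$ for which there is a $\Sigma^0_1$ formula $\varphi(x,y)$ of $L_1(X,\vec f)$ (existential number quantifiers followed by a bounded formula, in which $X$ and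 $\vec f$ may occur) without parameters such that (a) $\mathcal A\mathsf{RA}_1\vdash\forall x\exists!y\,\varphi(x,y)$ and (b) for all $X\subseteq\mathbb N$ and $x\in\mathbb N$ the standard model $(\mathbb N,X,\vec f)$ satisfies $\varphi(x,f(x,X))$. -}

module Defs where

open import Data.Bool.Base using (Bool; true; false; if_then_else_; T)
open import Data.Bool.Properties using (¬-not)
open import Data.Empty using (⊥)
open import Data.Fin.Base using (Fin; zero; suc)
open import Data.List.Base using (List; []; _∷_; map)
open import Data.List.Membership.Propositional using (_∈_)
open import Data.List.Relation.Unary.All using (All; []; _∷_)
import Data.List.Relation.Unary.All as All
open import Data.Nat.Base
open import Data.Nat.Properties
open import Data.Nat.Tactic.RingSolver using (solve-∀)
open import Data.Product using (Σ; ∃; _×_; _,_; proj₁; proj₂)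
import Data.Product.Base as Product
open import Data.Sum.Base using (_⊎_; inj₁; inj₂)
import Data.Sum.Base as Sum
open import Data.Unit.Base using (⊤; tt)
open import Data.Vec.Base using (Vec; []; _∷_; lookup)
import Data.Vec.Functional as F
open import Function.Base using (_∘_; id; case_of_)
open import Relation.Binary.Definitions using (tri<; tri≈; tri>)
open import Relation.Binary.PropositionalEquality hiding ([_])

Subset : Set
Subset = ℕ → Bool

-- triangle n = n (n + 1) / 2
triangle : ℕ → ℕ
triangle zero    = zero
triangle (suc n) = suc n + triangle n

triangle-spec : ∀ n → 2 * triangle n ≡ n * (n + 1)
triangle-spec zero    = refl
triangle-spec (suc n) = begin
  2 * (suc n + triangle n)       ≡⟨ *-distribˡ-+ 2 (suc n) (triangle n) ⟩
  2 * suc n + 2 * triangle n     ≡⟨ cong (2 * suc n +_) (triangle-spec n) ⟩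
  2 * suc n + n * (n + 1)        ≡⟨ expand n ⟩
  suc n * (suc n + 1)            ∎
  where
  open ≡-Reasoning
  expand : ∀ n → 2 * suc n + n * (n + 1) ≡ suc n * (suc n + 1)
  expand = solve-∀

n≤triangle : ∀ n → n ≤ triangle n
n≤triangle zero    = z≤n
n≤triangle (suc n) = m≤m+n (suc n) (triangle n)

-- The successor in the enumeration of ℕ × ℕ by values of `pair`, which
-- is a bijection from ℕ × ℕ onto the positive numbers.
next : ℕ × ℕ → ℕ × ℕ
next (x , zero)  = zero , suc x
next (x , suc y) = suc x , y

-- Opaque, so that terms built from `pair`, `hd` and `tl` do not unfold.
opaque
  -- 2 · pair x y = (x + y) (x + y + 1) + 2 x + 2; see `pair-spec`.
  pair : ℕ → ℕ → ℕ
  pair x y = suc (triangle (x + y) + x)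

  unpair : ℕ → ℕ × ℕ
  unpair zero          = zero , zero
  unpair (suc zero)    = zero , zero
  unpair (suc (suc n)) = next (unpair (suc n))

  hd tl : ℕ → ℕ
  hd z = proj₁ (unpair z)
  tl z = proj₂ (unpair z)

  hd-zero : hd 0 ≡ 0
  hd-zero = refl

  tl-zero : tl 0 ≡ 0
  tl-zero = refl

  pair-spec : ∀ x y → 2 * pair x y ≡ (x + y) * (x + y + 1) + 2 * x + 2
  pair-spec x y = begin
    2 * suc (triangle (x + y) + x)       ≡⟨ expand (triangle (x + y)) x ⟩
    2 * triangle (x + y) + 2 * x + 2     ≡⟨ cong (λ n → n + 2 * x + 2) (triangle-spec (x + y)) ⟩
    (x + y) * (x + y + 1) + 2 * x + 2    ∎
    where
    open ≡-Reasoning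
    expand : ∀ t x → 2 * suc (t + x) ≡ 2 * t + 2 * x + 2
    expand = solve-∀

  pair-next : ∀ x y → pair (proj₁ (next (x , y))) (proj₂ (next (x , y))) ≡ suc (pair x y)
  pair-next x zero    = cong suc (begin
    suc x + triangle x + 0      ≡⟨ expand x (triangle x) ⟩
    suc (triangle x + x)        ≡⟨ cong (λ n → suc (triangle n + x)) (+-identityʳ x) ⟨
    suc (triangle (x + 0) + x)  ∎)
    where
    open ≡-Reasoning
    expand : ∀ x t → suc x + t + 0 ≡ suc (t + x)
    expand = solve-∀
  pair-next x (suc y) = cong suc (begin
    triangle (suc x + y) + suc x    ≡⟨ cong (λ n → triangle n + suc x) (+-suc x y) ⟨
    triangle (x + suc y) + suc x    ≡⟨ +-suc (triangle (x + suc y)) x ⟩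
    suc (triangle (x + suc y) + x)  ∎)
    where open ≡-Reasoning

  pair-unpair : ∀ n → pair (hd (suc n)) (tl (suc n)) ≡ suc n
  pair-unpair zero    = refl
  pair-unpair (suc n) =
    trans (pair-next (hd (suc n)) (tl (suc n))) (cong suc (pair-unpair n))

  unpair-pair : ∀ x y → unpair (pair x y) ≡ (x , y)
  unpair-pair x y = go (x + y) x y refl
    where
    step : ∀ x y → unpair (pair x y) ≡ (x , y) →
           ∀ {z} → z ≡ suc (pair x y) → unpair z ≡ next (x , y)
    step x y ih refl = cong next ih
    go : ∀ s x y → x + y ≡ s → unpair (pair x y) ≡ (x , y)
    go s       zero    zero    _  = refl
    go (suc s) zero    (suc y) eq =
      step y 0 (go s y 0 (trans (+-identityʳ y) (suc-injective eq))) (pair-next y 0)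
    go s       (suc x) y       eq =
      step x (suc y) (go s x (suc y) (trans (+-suc x y) eq)) (pair-next x (suc y))

  hd-pair : ∀ x y → hd (pair x y) ≡ x
  hd-pair x y = cong proj₁ (unpair-pair x y)

  tl-pair : ∀ x y → tl (pair x y) ≡ y
  tl-pair x y = cong proj₂ (unpair-pair x y)

  fst<pair : ∀ x y → x < pair x y
  fst<pair x y = s≤s (m≤n+m x (triangle (x + y)))

  snd<pair : ∀ x y → y < pair x y
  snd<pair x y = s≤s (≤-trans (≤-trans (m≤n+m y x) (n≤triangle (x + y))) (m≤m+n _ x))

-- L₁ extended by a unary predicate symbol for each element of P, with
-- de Bruijn indices: `var zero` is bound by the innermost quantifier.

data Term (n : ℕ) : Set where
  var     : Fin n → Term n
  𝟎       : Term n
  𝐒 𝐇 𝐓   : Term n → Term n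
  _⊕_ _⊗_ : Term n → Term n → Term n
  ⟨_,_⟩   : Term n → Term n → Term n

infixl 8 _⊗_
infixl 7 _⊕_
infix  6 _≐_ _≺_ _ε_
infixr 5 _∧′_
infixr 4 _∨′_
infixr 3 _⇒_ _⇿_

data Formula (P : Set) (n : ℕ) : Set where
  _≐_ _≺_         : Term n → Term n → Formula P n
  _ε_             : Term n → P → Formula P n
  ⊥′              : Formula P n
  _⇒_ _∧′_ _∨′_   : Formula P n → Formula P n → Formula P n
  all ex          : Formula P (suc n) → Formula P n

Sentence : Set → Set
Sentence P = Formula P 0

Ren Sub : ℕ → ℕ → Set
Ren m n = Fin m → Fin n
Sub m n = Fin m → Term n

renT : ∀ {m n} → Ren m n → Term m → Term n
renT r (var i)   = var (r i)
renT r 𝟎         = 𝟎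
renT r (𝐒 t)     = 𝐒 (renT r t)
renT r (𝐇 t)     = 𝐇 (renT r t)
renT r (𝐓 t)     = 𝐓 (renT r t)
renT r (t ⊕ s)   = renT r t ⊕ renT r s
renT r (t ⊗ s)   = renT r t ⊗ renT r s
renT r ⟨ t , s ⟩ = ⟨ renT r t , renT r s ⟩

subT : ∀ {m n} → Sub m n → Term m → Term n
subT σ (var i)   = σ i
subT σ 𝟎         = 𝟎
subT σ (𝐒 t)     = 𝐒 (subT σ t)
subT σ (𝐇 t)     = 𝐇 (subT σ t)
subT σ (𝐓 t)     = 𝐓 (subT σ t)
subT σ (t ⊕ s)   = subT σ t ⊕ subT σ s
subT σ (t ⊗ s)   = subT σ t ⊗ subT σ s
subT σ ⟨ t , s ⟩ = ⟨ subT σ t , subT σ s ⟩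

liftS : ∀ {m n} → Sub m n → Sub (suc m) (suc n)
liftS σ zero    = var zero
liftS σ (suc i) = renT suc (σ i)

sub : ∀ {P m n} → Sub m n → Formula P m → Formula P n
sub σ (t ≐ s)  = subT σ t ≐ subT σ s
sub σ (t ≺ s)  = subT σ t ≺ subT σ s
sub σ (t ε p)  = subT σ t ε p
sub σ ⊥′       = ⊥′
sub σ (φ ⇒ ψ)  = sub σ φ ⇒ sub σ ψ
sub σ (φ ∧′ ψ) = sub σ φ ∧′ sub σ ψ
sub σ (φ ∨′ ψ) = sub σ φ ∨′ sub σ ψ
sub σ (all φ)  = all (sub (liftS σ) φ)
sub σ (ex φ)   = ex (sub (liftS σ) φ)

infix 9 _[_]
_[_] : ∀ {P n} → Formula P (suc n) → Term n → Formula P n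
φ [ t ] = sub (λ { zero → t ; (suc i) → var i }) φ

wk : ∀ {P n} → Formula P n → Formula P (suc n)
wk = sub (var ∘ suc)

embed : ∀ {P n} → Sentence P → Formula P n
embed = sub (λ ())

mapP : ∀ {P Q n} → (P → Q) → Formula P n → Formula Q n
mapP h (t ≐ s)  = t ≐ s
mapP h (t ≺ s)  = t ≺ s
mapP h (t ε p)  = t ε h p
mapP h ⊥′       = ⊥′
mapP h (φ ⇒ ψ)  = mapP h φ ⇒ mapP h ψ
mapP h (φ ∧′ ψ) = mapP h φ ∧′ mapP h ψ
mapP h (φ ∨′ ψ) = mapP h φ ∨′ mapP h ψ
mapP h (all φ)  = all (mapP h φ)
mapP h (ex φ)   = ex (mapP h φ)

¬′ : ∀ {P n} → Formula P n → Formula P n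
¬′ φ = φ ⇒ ⊥′

_⇿_ : ∀ {P n} → Formula P n → Formula P n → Formula P n
φ ⇿ ψ = (φ ⇒ ψ) ∧′ (ψ ⇒ φ)

infix 6 _≼_
_≼_ : ∀ {P n} → Term n → Term n → Formula P n
t ≼ s = t ≺ s ∨′ t ≐ s

𝟏 𝟐 : ∀ {n} → Term n
𝟏 = 𝐒 𝟎
𝟐 = 𝐒 (𝐒 𝟎)

-- p(t) = s for a set p regarded as a function
infix 6 _⦅_⦆≐_
_⦅_⦆≐_ : ∀ {P n} → P → Term n → Term n → Formula P n
p ⦅ t ⦆≐ s = ⟨ t , s ⟩ ε p

all≺ ex≺ : ∀ {P n} → Term n → Formula P (suc n) → Formula P n
all≺ t φ = all (var zero ≺ renT suc t ⇒ φ)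
ex≺  t φ = ex (var zero ≺ renT suc t ∧′ φ)

∃!′ : ∀ {P n} → Formula P (suc n) → Formula P n
∃!′ φ = ex (φ ∧′ all (sub other φ ⇒ var zero ≐ var (suc zero)))
  where
  other : Sub _ _
  other zero    = var zero
  other (suc i) = var (suc (suc i))

-- The universal closure binds index n - 1 outermost and index 0 innermost.
closure : ∀ {P} n → Formula P n → Sentence P
closure zero    φ = φ
closure (suc n) φ = closure n (all φ)

QuantifierFree : ∀ {P n} → Formula P n → Set
QuantifierFree (_ ≐ _)  = ⊤
QuantifierFree (_ ≺ _)  = ⊤
QuantifierFree (_ ε _)  = ⊤
QuantifierFree ⊥′       = ⊤
QuantifierFree (φ ⇒ ψ)  = QuantifierFree φ × QuantifierFree ψ
QuantifierFree (φ ∧′ ψ) = QuantifierFree φ × QuantifierFree ψ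
QuantifierFree (φ ∨′ ψ) = QuantifierFree φ × QuantifierFree ψ
QuantifierFree (all _)  = ⊥
QuantifierFree (ex _)   = ⊥

_OccursIn_ : ∀ {P n} → P → Formula P n → Set
p OccursIn (_ ≐ _)  = ⊥
p OccursIn (_ ≺ _)  = ⊥
p OccursIn (_ ε q)  = p ≡ q
p OccursIn ⊥′       = ⊥
p OccursIn (φ ⇒ ψ)  = p OccursIn φ ⊎ p OccursIn ψ
p OccursIn (φ ∧′ ψ) = p OccursIn φ ⊎ p OccursIn ψ
p OccursIn (φ ∨′ ψ) = p OccursIn φ ⊎ p OccursIn ψ
p OccursIn (all φ)  = p OccursIn φ
p OccursIn (ex φ)   = p OccursIn φ

-- Quantifiers ∀ x < t and ∃ x < t, where the bound t cannot contain x;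
-- x ≤ t is obtained as x < 𝐒 t.
data Bounded {P : Set} {n : ℕ} : Formula P n → Set where
  b≐  : ∀ {t s} → Bounded (t ≐ s)
  b≺  : ∀ {t s} → Bounded (t ≺ s)
  bε  : ∀ {t p} → Bounded (t ε p)
  b⊥  : Bounded ⊥′
  b⇒  : ∀ {φ ψ} → Bounded φ → Bounded ψ → Bounded (φ ⇒ ψ)
  b∧  : ∀ {φ ψ} → Bounded φ → Bounded ψ → Bounded (φ ∧′ ψ)
  b∨  : ∀ {φ ψ} → Bounded φ → Bounded ψ → Bounded (φ ∨′ ψ)
  b∀  : ∀ t {φ} → Bounded φ → Bounded (all≺ t φ)
  b∃  : ∀ t {φ} → Bounded φ → Bounded (ex≺ t φ)

data Σ₁ {P : Set} {n : ℕ} : Formula P n → Set where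
  bounded : ∀ {φ} → Bounded φ → Σ₁ φ
  exists  : ∀ {φ} → Σ₁ φ → Σ₁ (ex φ)

-- Sat interprets the L₁-part standardly in ℕ and the predicate symbols
-- by I; atomic formulas over Subset = ℕ → Bool are decidable.

eval : ∀ {n} → Vec ℕ n → Term n → ℕ
eval ρ (var i)   = lookup ρ i
eval ρ 𝟎         = 0
eval ρ (𝐒 t)     = suc (eval ρ t)
eval ρ (𝐇 t)     = hd (eval ρ t)
eval ρ (𝐓 t)     = tl (eval ρ t)
eval ρ (t ⊕ s)   = eval ρ t + eval ρ s
eval ρ (t ⊗ s)   = eval ρ t * eval ρ s
eval ρ ⟨ t , s ⟩ = pair (eval ρ t) (eval ρ s)

Sat : ∀ {P n} → (P → Subset) → Vec ℕ n → Formula P n → Set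
Sat I ρ (t ≐ s)  = eval ρ t ≡ eval ρ s
Sat I ρ (t ≺ s)  = eval ρ t < eval ρ s
Sat I ρ (t ε p)  = I p (eval ρ t) ≡ true
Sat I ρ ⊥′       = ⊥
Sat I ρ (φ ⇒ ψ)  = Sat I ρ φ → Sat I ρ ψ
Sat I ρ (φ ∧′ ψ) = Sat I ρ φ × Sat I ρ ψ
Sat I ρ (φ ∨′ ψ) = Sat I ρ φ ⊎ Sat I ρ ψ
Sat I ρ (all φ)  = ∀ a → Sat I (a ∷ ρ) φ
Sat I ρ (ex φ)   = ∃ λ a → Sat I (a ∷ ρ) φ

infix 2 _⊨_
_⊨_ : ∀ {P} → (P → Subset) → Sentence P → Set
I ⊨ φ = Sat I [] φ

-- Classical natural deduction with equality; `raa` is the only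
-- non-intuitionistic rule, and ex falso is an instance of it.

data Derives {P : Set} (Th : Sentence P → Set) {n : ℕ} (Γ : List (Formula P n)) :
             Formula P n → Set where
  axiom : ∀ {φ} → Th φ → Derives Th Γ (embed φ)
  hyp   : ∀ {φ} → φ ∈ Γ → Derives Th Γ φ
  ⇒I    : ∀ {φ ψ} → Derives Th (φ ∷ Γ) ψ → Derives Th Γ (φ ⇒ ψ)
  ⇒E    : ∀ {φ ψ} → Derives Th Γ (φ ⇒ ψ) → Derives Th Γ φ → Derives Th Γ ψ
  ∧I    : ∀ {φ ψ} → Derives Th Γ φ → Derives Th Γ ψ → Derives Th Γ (φ ∧′ ψ)
  ∧E₁   : ∀ {φ ψ} → Derives Th Γ (φ ∧′ ψ) → Derives Th Γ φ
  ∧E₂   : ∀ {φ ψ} → Derives Th Γ (φ ∧′ ψ) → Derives Th Γ ψ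
  ∨I₁   : ∀ {φ ψ} → Derives Th Γ φ → Derives Th Γ (φ ∨′ ψ)
  ∨I₂   : ∀ {φ ψ} → Derives Th Γ ψ → Derives Th Γ (φ ∨′ ψ)
  ∨E    : ∀ {φ ψ χ} → Derives Th Γ (φ ∨′ ψ) →
          Derives Th (φ ∷ Γ) χ → Derives Th (ψ ∷ Γ) χ → Derives Th Γ χ
  raa   : ∀ {φ} → Derives Th (¬′ φ ∷ Γ) ⊥′ → Derives Th Γ φ
  ∀I    : ∀ {φ} → Derives Th (map wk Γ) φ → Derives Th Γ (all φ)
  ∀E    : ∀ {φ} → Derives Th Γ (all φ) → ∀ t → Derives Th Γ (φ [ t ])
  ∃I    : ∀ {φ} t → Derives Th Γ (φ [ t ]) → Derives Th Γ (ex φ)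
  ∃E    : ∀ {φ ψ} → Derives Th Γ (ex φ) →
          Derives Th (φ ∷ map wk Γ) (wk ψ) → Derives Th Γ ψ
  =I    : ∀ t → Derives Th Γ (t ≐ t)
  =E    : ∀ {t s} (φ : Formula P (suc n)) →
          Derives Th Γ (t ≐ s) → Derives Th Γ (φ [ t ]) → Derives Th Γ (φ [ s ])

infix 2 _⊢_
_⊢_ : ∀ {P} → (Sentence P → Set) → Sentence P → Set
Th ⊢ φ = Derives Th [] φ

v₀ : ∀ {n} → Term (1 + n)
v₀ = var zero
v₁ : ∀ {n} → Term (2 + n)
v₁ = var (suc zero)
v₂ : ∀ {n} → Term (3 + n)
v₂ = var (suc (suc zero))
v₃ : ∀ {n} → Term (4 + n)
v₃ = var (suc (suc (suc zero)))

BASIC : ∀ {P} → List (Sentence P)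
BASIC =
    closure 1 (let x = v₀ in ¬′ (𝐒 x ≐ 𝟎))
  ∷ closure 2 (let x = v₀ ; y = v₁ in 𝐒 x ≐ 𝐒 y ⇒ x ≐ y)
  ∷ closure 1 (let x = v₀ in x ⊕ 𝟎 ≐ x)
  ∷ closure 2 (let x = v₀ ; y = v₁ in x ⊕ 𝐒 y ≐ 𝐒 (x ⊕ y))
  ∷ closure 1 (let x = v₀ in x ⊗ 𝟎 ≐ 𝟎)
  ∷ closure 2 (let x = v₀ ; y = v₁ in x ⊗ 𝐒 y ≐ x ⊗ y ⊕ x)
  ∷ closure 1 (let x = v₀ in ¬′ (x ≺ 𝟎))
  ∷ closure 2 (let x = v₀ ; y = v₁ in x ≺ 𝐒 y ⇿ x ≺ y ∨′ x ≐ y)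
  ∷ closure 2 (let x = v₀ ; y = v₁ in x ≺ y ∨′ x ≐ y ∨′ y ≺ x)
  ∷ closure 1 (𝟎 ≺ v₀ ⇒ ex≺ v₀ (let y = v₀ ; x = v₁ in 𝐒 y ≐ x))
  ∷ closure 3 (let x = v₀ ; y = v₁ ; z = v₂ in
      ⟨ x , y ⟩ ≐ z ⇿ 𝟐 ⊗ z ≐ (x ⊕ y) ⊗ (x ⊕ y ⊕ 𝟏) ⊕ 𝟐 ⊗ x ⊕ 𝟐)
  ∷ closure 4 (let x = v₀ ; y = v₁ ; x′ = v₂ ; y′ = v₃ in
      ⟨ x , y ⟩ ≐ ⟨ x′ , y′ ⟩ ⇒ x ≐ x′ ∧′ y ≐ y′)
  ∷ closure 1 (𝟎 ≺ v₀ ⇒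
      ex≺ v₀ (ex≺ v₁ (let y = v₀ ; x = v₁ ; z = v₂ in ⟨ x , y ⟩ ≐ z)))
  ∷ closure 2 (let x = v₀ ; y = v₁ in 𝐇 ⟨ x , y ⟩ ≐ x)
  ∷ 𝐇 𝟎 ≐ 𝟎
  ∷ closure 2 (let x = v₀ ; y = v₁ in 𝐓 ⟨ x , y ⟩ ≐ y)
  ∷ 𝐓 𝟎 ≐ 𝟎
  ∷ []

𝓕 : ∀ {P} → P → Sentence P
𝓕 f = all (ex (let y = v₀ ; x = v₁ in ⟨ x , y ⟩ ε f))
    ∧′ closure 3 (let x = v₀ ; y = v₁ ; y′ = v₂ in
         ⟨ x , y ⟩ ε f ∧′ ⟨ x , y′ ⟩ ε f ⇒ y ≐ y′)
    ∧′ ¬′ (𝟎 ε f)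

-- f := op(g₁,…,gₙ) as the universal closure of `matrix`; the set
-- variables are f = zero and gᵢ = suc i.
record Spec : Set where
  constructor mkSpec
  field
    arity   : ℕ
    numVars : ℕ
    matrix  : Formula (Fin (suc arity)) numVars

  sentence : Sentence (Fin (suc arity))
  sentence = closure numVars matrix

-- The set constant X is not among the set variables of an operator, so
-- the requirement of unique existence needs no quantification over X.
-- Uniqueness of f is up to extensional equality.
record Operator : Set where
  field
    spec : Spec
  open Spec spec public
  field
    quantifierFree : QuantifierFree matrix
    allOccur       : ∀ p → p OccursIn matrix
    uniquely       : (g : Fin arity → Subset) → (∀ i → g ⊨ 𝓕 i) →
      Σ Subset λ f →
        ((f F.∷ g) ⊨ sentence) × ((f F.∷ g) ⊨ 𝓕 zero) ×
        (∀ f′ → (f′ F.∷ g) ⊨ sentence → (f′ F.∷ g) ⊨ 𝓕 zero → f′ ≗ f)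

f₀ : ∀ {n} → Fin (1 + n)
f₀ = zero
g₁ : ∀ {n} → Fin (2 + n)
g₁ = suc zero
h₂ : ∀ {n} → Fin (3 + n)
h₂ = suc (suc zero)

S-spec ⊕-spec ⊗-spec <-spec I-spec D-spec P-spec ∘-spec μ-spec : Spec

S-spec = mkSpec 0 1 (let x = v₀ in f₀ ⦅ x ⦆≐ 𝐒 x)

⊕-spec = mkSpec 0 2 (let x = v₀ ; y = v₁ in
  f₀ ⦅ ⟨ x , y ⟩ ⦆≐ x ⊕ y ∧′ f₀ ⦅ 𝟎 ⦆≐ 𝟎)

⊗-spec = mkSpec 0 2 (let x = v₀ ; y = v₁ in
  f₀ ⦅ ⟨ x , y ⟩ ⦆≐ x ⊗ y ∧′ f₀ ⦅ 𝟎 ⦆≐ 𝟎)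

<-spec = mkSpec 0 2 (let x = v₀ ; y = v₁ in
     (x ≺ y ⇒ f₀ ⦅ ⟨ x , y ⟩ ⦆≐ 𝟏)
  ∧′ (y ≼ x ⇒ f₀ ⦅ ⟨ x , y ⟩ ⦆≐ 𝟎)
  ∧′ f₀ ⦅ 𝟎 ⦆≐ 𝟎)

I-spec = mkSpec 0 1 (let x = v₀ in f₀ ⦅ x ⦆≐ x)

D-spec = mkSpec 0 3 (let x = v₀ ; y = v₁ ; z = v₂ in
     f₀ ⦅ ⟨ 𝟎 , ⟨ y , z ⟩ ⟩ ⦆≐ y
  ∧′ f₀ ⦅ ⟨ 𝐒 x , ⟨ y , z ⟩ ⟩ ⦆≐ z
  ∧′ f₀ ⦅ 𝟎 ⦆≐ 𝟎
  ∧′ f₀ ⦅ ⟨ x , 𝟎 ⟩ ⦆≐ 𝟎)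

P-spec = mkSpec 2 3 (let x = v₀ ; v = v₁ ; w = v₂ in
  g₁ ⦅ x ⦆≐ v ∧′ h₂ ⦅ x ⦆≐ w ⇒ f₀ ⦅ x ⦆≐ ⟨ v , w ⟩)

∘-spec = mkSpec 2 3 (let x = v₀ ; y = v₁ ; z = v₂ in
  h₂ ⦅ x ⦆≐ z ∧′ g₁ ⦅ z ⦆≐ y ⇒ f₀ ⦅ x ⦆≐ y)

μ-spec = mkSpec 1 4 (let b = v₀ ; x = v₁ ; y = v₂ ; z = v₃ in
     (f₀ ⦅ ⟨ b , x ⟩ ⦆≐ z ⇒ z ≼ b)
  ∧′ (f₀ ⦅ ⟨ b , x ⟩ ⦆≐ z ∧′ y ≺ b ∧′ g₁ ⦅ ⟨ y , x ⟩ ⦆≐ 𝟏 ⇒ z ≼ y)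
  ∧′ (f₀ ⦅ ⟨ b , x ⟩ ⦆≐ z ∧′ z ≺ b ⇒ g₁ ⦅ ⟨ z , x ⟩ ⦆≐ 𝟏)
  ∧′ f₀ ⦅ 𝟎 ⦆≐ 𝟎)

requiredSpecs : List Spec
requiredSpecs = S-spec ∷ ⊕-spec ∷ ⊗-spec ∷ <-spec ∷ I-spec ∷ D-spec
              ∷ P-spec ∷ ∘-spec ∷ μ-spec ∷ []

record AlgebraClass : Set where
  field
    size     : ℕ
    operator : Fin size → Operator
    required : All (λ s → ∃ λ i → Operator.spec (operator i) ≡ s) requiredSpecs

  arityOf : Fin size → ℕ
  arityOf i = Operator.arity (operator i)

oracleDef : ∀ {P} → P → P → Sentence P
oracleDef X f = closure 1 (let x = v₀ in
  (x ε X ⇒ f ⦅ x ⦆≐ 𝟏) ∧′ (¬′ (x ε X) ⇒ f ⦅ x ⦆≐ 𝟎))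

⊨BASIC : ∀ {P} (I : P → Subset) → All (I ⊨_) BASIC
⊨BASIC I =
    (λ _ ())
  ∷ (λ y x → suc-injective)
  ∷ +-identityʳ
  ∷ (λ y x → +-suc x y)
  ∷ *-zeroʳ
  ∷ (λ y x → trans (*-suc x y) (+-comm x (x * y)))
  ∷ (λ _ ())
  ∷ (λ y x → (λ { (s≤s x≤y) → m≤n⇒m<n∨m≡n x≤y })
            , (λ { (inj₁ x<y) → m<n⇒m<1+n x<y ; (inj₂ refl) → ≤-refl }))
  ∷ (λ y x → trichotomy x y)
  ∷ (λ { (suc y) _ → y , ≤-refl , refl })
  ∷ (λ { z y x → (λ { refl → pair-spec x y })
               , (λ eq → *-cancelˡ-≡ (pair x y) z 2 (trans (pair-spec x y) (sym eq))) })
  ∷ (λ y′ x′ y x eq →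
        trans (sym (hd-pair x y)) (trans (cong hd eq) (hd-pair x′ y′))
      , trans (sym (tl-pair x y)) (trans (cong tl eq) (tl-pair x′ y′)))
  ∷ (λ { (suc n) _ →
          hd (suc n) , subst (hd (suc n) <_) (pair-unpair n) (fst<pair _ (tl (suc n)))
        , tl (suc n) , subst (tl (suc n) <_) (pair-unpair n) (snd<pair (hd (suc n)) _)
        , pair-unpair n })
  ∷ (λ y x → hd-pair x y)
  ∷ hd-zero
  ∷ (λ y x → tl-pair x y)
  ∷ tl-zero
  ∷ []
  where
  trichotomy : ∀ x y → x < y ⊎ x ≡ y ⊎ y < x
  trichotomy x y with <-cmp x y
  ... | tri< x<y _ _ = inj₁ x<y
  ... | tri≈ _ x≡y _ = inj₂ (inj₁ x≡y)
  ... | tri> _ _ x>y = inj₂ (inj₂ x>y)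

Sat-mapP : ∀ {P Q n} (h : P → Q) {I : P → Subset} {J : Q → Subset} →
           (∀ p → J (h p) ≗ I p) → ∀ (ρ : Vec ℕ n) φ →
           (Sat J ρ (mapP h φ) → Sat I ρ φ) × (Sat I ρ φ → Sat J ρ (mapP h φ))
Sat-mapP h e ρ (t ≐ s)  = id , id
Sat-mapP h e ρ (t ≺ s)  = id , id
Sat-mapP h e ρ (t ε p)  = trans (sym (e p _)) , trans (e p _)
Sat-mapP h e ρ ⊥′       = id , id
Sat-mapP h e ρ (φ ⇒ ψ)  with Sat-mapP h e ρ φ | Sat-mapP h e ρ ψ
... | a , a′ | b , b′   = (λ k → b ∘ k ∘ a′) , (λ k → b′ ∘ k ∘ a)
Sat-mapP h e ρ (φ ∧′ ψ) with Sat-mapP h e ρ φ | Sat-mapP h e ρ ψ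
... | a , a′ | b , b′   = Product.map a b , Product.map a′ b′
Sat-mapP h e ρ (φ ∨′ ψ) with Sat-mapP h e ρ φ | Sat-mapP h e ρ ψ
... | a , a′ | b , b′   = Sum.map a b , Sum.map a′ b′
Sat-mapP h e ρ (all φ)  =
    (λ k n → proj₁ (Sat-mapP h e (n ∷ ρ) φ) (k n))
  , (λ k n → proj₂ (Sat-mapP h e (n ∷ ρ) φ) (k n))
Sat-mapP h e ρ (ex φ)   =
    (λ { (n , k) → n , proj₁ (Sat-mapP h e (n ∷ ρ) φ) k })
  , (λ { (n , k) → n , proj₂ (Sat-mapP h e (n ∷ ρ) φ) k })

_∈𝓕 : Subset → Set
f ∈𝓕 = (λ _ → f) ⊨ 𝓕 tt

opaque
  unfolding pair

  graph : (ℕ → ℕ) → Subset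
  graph F zero      = false
  graph F z@(suc _) = tl z ≡ᵇ F (hd z)

  graph-pair : ∀ F x y → graph F (pair x y) ≡ (y ≡ᵇ F x)
  graph-pair F x y = cong (λ z → proj₂ z ≡ᵇ F (proj₁ z)) (unpair-pair x y)

  graph-value : ∀ F x → graph F (pair x (F x)) ≡ true
  graph-value F x = trans (graph-pair F x (F x)) (≡ᵇ-refl (F x))
    where
    ≡ᵇ-refl : ∀ n → (n ≡ᵇ n) ≡ true
    ≡ᵇ-refl zero    = refl
    ≡ᵇ-refl (suc n) = ≡ᵇ-refl n

  graph-value⁻¹ : ∀ F x y → graph F (pair x y) ≡ true → y ≡ F x
  graph-value⁻¹ F x y p =
    ≡ᵇ⇒≡ y (F x) (subst T (trans (sym p) (graph-pair F x y)) tt)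

  graph-zero : ∀ F → graph F 0 ≡ false
  graph-zero F = refl

graph∈𝓕 : ∀ F → graph F ∈𝓕
graph∈𝓕 F =
    (λ x → F x , graph-value F x)
  , (λ { y′ y x (p , q) →
         trans (graph-value⁻¹ F x y p) (sym (graph-value⁻¹ F x y′ q)) })
  , (λ p → case trans (sym p) (graph-zero F) of λ ())

graph-unique : ∀ f F → f ∈𝓕 → (∀ x → f (pair x (F x)) ≡ true) → f ≗ graph F
graph-unique f F (_ , _ , 0∉f) val zero = trans (¬-not 0∉f) (sym (graph-zero F))
graph-unique f F (_ , fun , _) val (suc n) =
  subst (λ z → f z ≡ graph F z) (pair-unpair n) (at (hd (suc n)) (tl (suc n)))
  where
  at : ∀ x y → f (pair x y) ≡ graph F (pair x y)
  at x y with f (pair x y) in fy | graph F (pair x y) in gy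
  ... | true  | true  = refl
  ... | false | false = refl
  ... | false | true  with graph-value⁻¹ F x y gy
  ...   | refl = trans (sym fy) (val x)
  at x y | true | false with fun (F x) y x (fy , val x)
  ...   | refl = trans (sym (graph-value F x)) gy

bit : Bool → ℕ
bit b = if b then 1 else 0

oracle : Subset → Subset
oracle X = graph (bit ∘ X)

oracle-value : ∀ X x {b} → X x ≡ b → oracle X (pair x (bit b)) ≡ true
oracle-value X x refl = graph-value (bit ∘ X) x

oracle⊨ : ∀ {P} (I : P → Subset) p q → I q ≡ oracle (I p) → I ⊨ oracleDef p q
oracle⊨ I p q e x rewrite e =
    oracle-value (I p) x
  , (λ x∉X → oracle-value (I p) x (¬-not x∉X))

oracle-unique : ∀ {P} (I : P → Subset) p q → I ⊨ oracleDef p q → I ⊨ 𝓕 q →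
                ∀ X → I p ≗ X → I q ≗ oracle X
oracle-unique I p q def q∈𝓕 X e = graph-unique (I q) (bit ∘ X) q∈𝓕 value
  where
  value : ∀ x → I q (pair x (bit (X x))) ≡ true
  value x with X x in eq
  ... | true  = proj₁ (def x) (trans (e x) eq)
  ... | false = proj₂ (def x) (λ x∈X → case trans (sym x∈X) (trans (e x) eq) of λ ())

module _ (𝒜 : AlgebraClass) where
  open AlgebraClass 𝒜

  data Derivation : Set where
    X⋆ : Derivation
    op : (i : Fin size) → Vec Derivation (arityOf i) → Derivation

  data SetConst : Set where
    X̂  : SetConst
    fn : Derivation → SetConst

  opConsts : ∀ i → Vec Derivation (arityOf i) → Fin (suc (arityOf i)) → SetConst
  opConsts i ds = fn (op i ds) F.∷ (fn ∘ lookup ds)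

  opDef : ∀ i → Vec Derivation (arityOf i) → Sentence SetConst
  opDef i ds = mapP (opConsts i ds) (Operator.sentence (operator i))

  data RA₁ : Sentence SetConst → Set where
    basic     : ∀ {φ} → φ ∈ BASIC → RA₁ φ
    oracleAx  : RA₁ (oracleDef X̂ (fn X⋆))
    oracle𝓕   : RA₁ (𝓕 (fn X⋆))
    opAx      : ∀ i ds → RA₁ (opDef i ds)
    op𝓕       : ∀ i ds → RA₁ (𝓕 (fn (op i ds)))

  IsModel : (SetConst → Subset) → Set
  IsModel I = ∀ φ → RA₁ φ → I ⊨ φ

  mutual
    interp : Subset → Derivation → Σ Subset _∈𝓕
    interp X X⋆        = oracle X , graph∈𝓕 (bit ∘ X)
    interp X (op i ds) = proj₁ u , proj₁ (proj₂ (proj₂ u))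
      where
      u = Operator.uniquely (operator i) (proj₁ ∘ interps X ds) (proj₂ ∘ interps X ds)

    interps : ∀ {n} → Subset → Vec Derivation n → Fin n → Σ Subset _∈𝓕
    interps X (d ∷ ds) zero    = interp X d
    interps X (d ∷ ds) (suc k) = interps X ds k

  standard : Subset → SetConst → Subset
  standard X X̂      = X
  standard X (fn d) = proj₁ (interp X d)

  -- (ℕ, X) expands to `standard X`, and to no other model of RA₁.

  interps-lookup : ∀ {n} X (ds : Vec Derivation n) k →
                   interps X ds k ≡ interp X (lookup ds k)
  interps-lookup X (d ∷ ds) zero    = refl
  interps-lookup X (d ∷ ds) (suc k) = interps-lookup X ds k

  standard-isModel : ∀ X → IsModel (standard X)
  standard-isModel X _ (basic φ∈B)  = All.lookup (⊨BASIC (standard X)) φ∈B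
  standard-isModel X _ oracleAx     = oracle⊨ (standard X) X̂ (fn X⋆) refl
  standard-isModel X _ oracle𝓕      = graph∈𝓕 (bit ∘ X)
  standard-isModel X _ (op𝓕 i ds)   = proj₂ (interp X (op i ds))
  standard-isModel X _ (opAx i ds)  =
    proj₂ (Sat-mapP (opConsts i ds) agree [] (Operator.sentence (operator i)))
          (proj₁ (proj₂ (Operator.uniquely (operator i)
                           (proj₁ ∘ interps X ds) (proj₂ ∘ interps X ds))))
    where
    agree : ∀ p → standard X (opConsts i ds p) ≗
                  (standard X (fn (op i ds)) F.∷ (proj₁ ∘ interps X ds)) p
    agree zero    _ = refl
    agree (suc k) z = cong (λ u → proj₁ u z) (sym (interps-lookup X ds k))

  mutual
    standard-unique : ∀ X I → IsModel I → I X̂ ≗ X → ∀ d → I (fn d) ≗ standard X (fn d)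
    standard-unique X I M e X⋆ =
      oracle-unique I X̂ (fn X⋆) (M _ oracleAx) (M _ oracle𝓕) X e
    standard-unique X I M e (op i ds) =
      proj₂ (proj₂ (proj₂ (Operator.uniquely (operator i)
                             (proj₁ ∘ interps X ds) (proj₂ ∘ interps X ds))))
        (I (fn (op i ds)))
        (proj₁ (Sat-mapP (opConsts i ds) agree [] (Operator.sentence (operator i)))
               (M _ (opAx i ds)))
        (M _ (op𝓕 i ds))
      where
      agree : ∀ p → I (opConsts i ds p) ≗
                    (I (fn (op i ds)) F.∷ (proj₁ ∘ interps X ds)) p
      agree zero    _ = refl
      agree (suc k)   = standard-uniques X I M e ds k

    standard-uniques : ∀ {n} X I → IsModel I → I X̂ ≗ X → ∀ (ds : Vec Derivation n) k →
                       I (fn (lookup ds k)) ≗ proj₁ (interps X ds k)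
    standard-uniques X I M e (d ∷ ds) zero    = standard-unique X I M e d
    standard-uniques X I M e (d ∷ ds) (suc k) = standard-uniques X I M e ds k

  -- In φ(x , y) the variable x has index 1 and y has index 0.
  ProvablyTotal : (ℕ → Subset → ℕ) → Set
  ProvablyTotal f = Σ (Formula SetConst 2) λ φ →
      Σ₁ φ
    × (RA₁ ⊢ all (∃!′ φ))
    × (∀ X x → Sat (standard X) (f x X ∷ x ∷ []) φ)

  Computes : Derivation → (ℕ → Subset → ℕ) → Set
  Computes d f = ∀ X x →
    Sat (standard X) (f x X ∷ x ∷ []) (let y = v₀ ; x = v₁ in fn d ⦅ x ⦆≐ y)

{-# OPTIONS --safe #-}
module Submission where

-- Why the theorem is true.  A derivation d gives the formula f_d(x) = y,
-- which is quantifier free and which is provably total by the axiom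
-- f_d ∈ 𝓕.  Conversely, all axioms of the theory are universal once the
-- bounded witnesses and the values of the functions f_d are named by
-- derivations, so that Herbrand’s theorem applies: if ∀x ∃!y φ(x , y) is
-- provable, then y is always among the values at x of finitely many
-- derivations, and a definition by cases merges these into one, because
-- bounded formulas have characteristic functions in the class.
--
-- Herbrand’s theorem is obtained here without eliminating cuts, from a
-- forcing interpretation of classical proofs.  The points are the pairs
-- (X , x); individuals are derivations, read as functions on points; and
-- conditions are derivations as well, read as decidable sets of points.
-- Given an ideal of conditions, a condition b forces an atomic formula
-- if each c ⊆ b on which the formula fails everywhere is in the ideal,
-- it forces falsity if b is in the ideal, and disjunction and existence
-- are read as ¬(¬ φ ∧ ¬ ψ) and ¬ ∀ ¬ φ.  Then:
--
--   * forcing is closed under double negation (`stable`), hence sound for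
--     reductio ad absurdum, and for all of natural deduction (`sound`);
--   * for a bounded formula, forcing amounts to the condition for atomic
--     formulas (`forces⇒locally`, `locally⇒forces`), and so the axioms,
--     which are true in every standard model, are forced.
--
-- Two ideals finish the proof.  In the first one, b is in the ideal if
-- some derivation d satisfies φ(x , f_d(x)) at all points of b.  Since
-- ∃y φ(x , y) is forced, the set of all points is in this ideal
-- (`provable⇒solution`).  In the second one, for a fixed point p₀ and
-- fixed values y and z, b is in the ideal if p₀ ∈ b implies y = z; it
-- yields the uniqueness of y in the standard model (`provable⇒unique`)
-- without assuming that truth in the standard model is decidable.

open import Defs
open import Data.Bool.Base using (true; false)
open import Data.Empty using (⊥-elim)
open import Data.Fin.Base using (zero; suc)
open import Data.List.Base using (List; []; _∷_)
import Data.List.Base as List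
open import Data.List.Membership.Propositional using (_∈_)
open import Data.List.Relation.Unary.All using (All; []; _∷_)
import Data.List.Relation.Unary.All as All
import Data.List.Relation.Unary.All.Properties as All
open import Data.List.Relation.Unary.Any using (here; there)
open import Data.Nat.Base using (ℕ; zero; suc; _+_; _*_; _<_; z≤n; s≤s)
open import Data.Nat.Properties
open import Data.Product using (∃; _×_; _,_; proj₁; proj₂)
open import Data.Sum.Base using (_⊎_; inj₁; inj₂; [_,_]′)
open import Data.Unit.Base using (tt)
open import Data.Vec.Base using (Vec; []; _∷_; lookup; map)
open import Data.Vec.Properties using (lookup-map)
import Data.Vec.Functional as F
open import Function.Base using (_∘_; id)
open import Function.Bundles using (_⇔_; mk⇔)
open import Relation.Binary.PropositionalEquality hiding ([_])
open import Relation.Nullary using (¬_; Dec; yes; no)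

-- Truth values

-- `Decides A n`: the number n is the truth value of A.
data Decides (A : Set) : ℕ → Set where
  holds : A → Decides A 1
  fails : ¬ A → Decides A 0

Decides-⇔ : ∀ {A B n} → (A → B) → (B → A) → Decides A n → Decides B n
Decides-⇔ to from (holds a) = holds (to a)
Decides-⇔ to from (fails a) = fails (a ∘ from)

Decides-≡ : ∀ {A B n} → A ≡ B → Decides A n → Decides B n
Decides-≡ {n = n} = subst (λ A → Decides A n)

toDec : ∀ {A n} → Decides A n → Dec A
toDec (holds a) = yes a
toDec (fails a) = no a

decides-1 : ∀ {A n} → Decides A n → A → n ≡ 1
decides-1 (holds _) _ = refl
decides-1 (fails n) a = ⊥-elim (n a)

decides-1⁻¹ : ∀ {A n} → Decides A n → n ≡ 1 → A
decides-1⁻¹ (holds a) _ = a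

decides-pos : ∀ {A n} → Decides A n → 0 < n → A
decides-pos (holds a) _ = a

-- The value of the operator D on triples
ifZ : ℕ → ℕ → ℕ → ℕ
ifZ zero    y z = y
ifZ (suc _) y z = z

-- Syntax

qf⇒bounded : ∀ {P n} (φ : Formula P n) → QuantifierFree φ → Bounded φ
qf⇒bounded (t ≐ s)  _       = b≐
qf⇒bounded (t ≺ s)  _       = b≺
qf⇒bounded (t ε p)  _       = bε
qf⇒bounded ⊥′       _       = b⊥
qf⇒bounded (φ ⇒ ψ)  (p , q) = b⇒ (qf⇒bounded φ p) (qf⇒bounded ψ q)
qf⇒bounded (φ ∧′ ψ) (p , q) = b∧ (qf⇒bounded φ p) (qf⇒bounded ψ q)
qf⇒bounded (φ ∨′ ψ) (p , q) = b∨ (qf⇒bounded φ p) (qf⇒bounded ψ q)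

mapP-qf : ∀ {P Q n} (h : P → Q) (φ : Formula P n) → QuantifierFree φ → QuantifierFree (mapP h φ)
mapP-qf h (t ≐ s)  _       = tt
mapP-qf h (t ≺ s)  _       = tt
mapP-qf h (t ε p)  _       = tt
mapP-qf h ⊥′       _       = tt
mapP-qf h (φ ⇒ ψ)  (p , q) = mapP-qf h φ p , mapP-qf h ψ q
mapP-qf h (φ ∧′ ψ) (p , q) = mapP-qf h φ p , mapP-qf h ψ q
mapP-qf h (φ ∨′ ψ) (p , q) = mapP-qf h φ p , mapP-qf h ψ q

mapP-closure : ∀ {P Q} (h : P → Q) n (φ : Formula P n) →
               mapP h (closure n φ) ≡ closure n (mapP h φ)
mapP-closure h zero    φ = refl
mapP-closure h (suc n) φ = mapP-closure h n (all φ)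

bound : ∀ {P n} (t : Term n) → Bounded {P} (v₀ ≺ renT suc t)
bound t = b≺

-- Derivations as functions on points

module Algebra (𝒜 : AlgebraClass) where
  open AlgebraClass 𝒜

  D : Set
  D = Derivation 𝒜

  -- Formulas of the language of the recursive arithmetic
  L : ℕ → Set
  L = Formula (SetConst 𝒜)

  -- The functions of the algebra take an oracle X and a number x.
  Point : Set
  Point = Subset × ℕ

  opaque
    -- The value of the function f_d of the standard model over X at x,
    -- taken from the totality of f_d.
    val : D → Point → ℕ
    val d (X , x) = proj₁ (proj₁ (proj₂ (interp 𝒜 X d)) x)

    val-graph : ∀ d X x → standard 𝒜 X (fn d) (pair x (val d (X , x))) ≡ true
    val-graph d X x = proj₂ (proj₁ (proj₂ (interp 𝒜 X d)) x)

    val-unique : ∀ d X x {y} → standard 𝒜 X (fn d) (pair x y) ≡ true → val d (X , x) ≡ y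
    val-unique d X x {y} e =
      proj₁ (proj₂ (proj₂ (interp 𝒜 X d))) y (val d (X , x)) x (val-graph d X x , e)

    0∉graph : ∀ d X → ¬ standard 𝒜 X (fn d) 0 ≡ true
    0∉graph d X = proj₂ (proj₂ (proj₂ (interp 𝒜 X d)))

  opaque
    -- The derivation obtained by applying a required operator.
    apply : ∀ {s} → s ∈ requiredSpecs → Vec D (Spec.arity s) → D
    apply s∈ = applyAt (All.lookup required s∈)
      where
      applyAt : ∀ {s} → (∃ λ i → Operator.spec (operator i) ≡ s) → Vec D (Spec.arity s) → D
      applyAt (i , refl) = op i

    -- In every standard model, `apply s∈ ds` satisfies the specification s.
    apply-sat : ∀ {s} (s∈ : s ∈ requiredSpecs) (ds : Vec D (Spec.arity s)) X →
                (standard 𝒜 X (fn (apply s∈ ds)) F.∷ (standard 𝒜 X ∘ fn ∘ lookup ds))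
                ⊨ Spec.sentence s
    apply-sat s∈ ds X with All.lookup required s∈
    ... | i , refl =
      proj₁ (Sat-mapP (opConsts 𝒜 i ds) (λ { zero _ → refl ; (suc k) _ → refl }) []
                      (Operator.sentence (operator i)))
            (standard-isModel 𝒜 X _ (opAx i ds))

  S∈ : S-spec ∈ requiredSpecs
  S∈ = here refl
  ⊕∈ : ⊕-spec ∈ requiredSpecs
  ⊕∈ = there (here refl)
  ⊗∈ : ⊗-spec ∈ requiredSpecs
  ⊗∈ = there (there (here refl))
  <∈ : <-spec ∈ requiredSpecs
  <∈ = there (there (there (here refl)))
  I∈ : I-spec ∈ requiredSpecs
  I∈ = there (there (there (there (here refl))))
  D∈ : D-spec ∈ requiredSpecs
  D∈ = there (there (there (there (there (here refl)))))
  P∈ : P-spec ∈ requiredSpecs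
  P∈ = there (there (there (there (there (there (here refl))))))
  ∘∈ : ∘-spec ∈ requiredSpecs
  ∘∈ = there (there (there (there (there (there (there (here refl)))))))
  μ∈ : μ-spec ∈ requiredSpecs
  μ∈ = there (there (there (there (there (there (there (there (here refl))))))))

  infixr 9 _∘ᴰ_
  opaque
    idᴰ : D
    idᴰ = apply I∈ []

    val-id : ∀ X x → val idᴰ (X , x) ≡ x
    val-id X x = val-unique _ X x (apply-sat I∈ [] X x)

    _∘ᴰ_ : D → D → D
    g ∘ᴰ h = apply ∘∈ (g ∷ h ∷ [])

    val-∘ : ∀ g h X x → val (g ∘ᴰ h) (X , x) ≡ val g (X , val h (X , x))
    val-∘ g h X x = val-unique _ X x
      (apply-sat ∘∈ (g ∷ h ∷ []) X _ _ x (val-graph h X x , val-graph g X _))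

    pairᴰ : D → D → D
    pairᴰ g h = apply P∈ (g ∷ h ∷ [])

    val-pair : ∀ g h p → val (pairᴰ g h) p ≡ pair (val g p) (val h p)
    val-pair g h (X , x) = val-unique _ X x
      (apply-sat P∈ (g ∷ h ∷ []) X _ _ x (val-graph g X x , val-graph h X x))

    val-∘-pair : ∀ d a b X x {z} →
                 standard 𝒜 X (fn d) (pair (pair (val a (X , x)) (val b (X , x))) z) ≡ true →
                 val (d ∘ᴰ pairᴰ a b) (X , x) ≡ z
    val-∘-pair d a b X x e = trans (val-∘ d (pairᴰ a b) X x)
      (trans (cong (λ n → val d (X , n)) (val-pair a b (X , x))) (val-unique d X _ e))

    sucᴰ : D → D
    sucᴰ a = apply S∈ [] ∘ᴰ a

    val-suc : ∀ a p → val (sucᴰ a) p ≡ suc (val a p)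
    val-suc a (X , x) = trans (val-∘ _ a X x) (val-unique _ X _ (apply-sat S∈ [] X _))

    _+ᴰ_ : D → D → D
    a +ᴰ b = apply ⊕∈ [] ∘ᴰ pairᴰ a b

    val-+ : ∀ a b p → val (a +ᴰ b) p ≡ val a p + val b p
    val-+ a b (X , x) = val-∘-pair _ a b X x (proj₁ (apply-sat ⊕∈ [] X _ _))

    _*ᴰ_ : D → D → D
    a *ᴰ b = apply ⊗∈ [] ∘ᴰ pairᴰ a b

    val-* : ∀ a b p → val (a *ᴰ b) p ≡ val a p * val b p
    val-* a b (X , x) = val-∘-pair _ a b X x (proj₁ (apply-sat ⊗∈ [] X _ _))

    _<ᴰ_ : D → D → D
    a <ᴰ b = apply <∈ [] ∘ᴰ pairᴰ a b

    val-< : ∀ a b p → Decides (val a p < val b p) (val (a <ᴰ b) p)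
    val-< a b (X , x) with val a (X , x) <? val b (X , x)
    ... | yes lt = subst (Decides _)
          (sym (val-∘-pair _ a b X x (proj₁ (apply-sat <∈ [] X _ _) lt))) (holds lt)
    ... | no nlt = subst (Decides _)
          (sym (val-∘-pair _ a b X x
            (proj₁ (proj₂ (apply-sat <∈ [] X _ _)) (m≤n⇒m<n∨m≡n (≮⇒≥ nlt))))) (fails nlt)

    -- x < x is false.
    zeroᴰ : D
    zeroᴰ = idᴰ <ᴰ idᴰ

    val-zero : ∀ p → val zeroᴰ p ≡ 0
    val-zero p with val zeroᴰ p | val-< idᴰ idᴰ p
    ... | _ | holds lt = ⊥-elim (<-irrefl refl lt)
    ... | _ | fails _  = refl

    constᴰ : ℕ → D
    constᴰ zero    = zeroᴰ
    constᴰ (suc k) = sucᴰ (constᴰ k)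

    val-const : ∀ k p → val (constᴰ k) p ≡ k
    val-const zero    p = val-zero p
    val-const (suc k) p = trans (val-suc (constᴰ k) p) (cong suc (val-const k p))

    -- `ifᴰ a b c` is b where a vanishes and c elsewhere.
    ifᴰ : D → D → D → D
    ifᴰ a b c = apply D∈ [] ∘ᴰ pairᴰ a (pairᴰ b c)

    val-if : ∀ a b c p → val (ifᴰ a b c) p ≡ ifZ (val a p) (val b p) (val c p)
    val-if a b c (X , x) = val-∘-pair _ a (pairᴰ b c) X x (at (val a (X , x)))
      where
      at : ∀ n → standard 𝒜 X (fn (apply D∈ []))
                   (pair (pair n (val (pairᴰ b c) (X , x)))
                         (ifZ n (val b (X , x)) (val c (X , x)))) ≡ true
      at n rewrite val-pair b c (X , x) with n
      ... | zero  = proj₁ (apply-sat D∈ [] X _ _ 0)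
      ... | suc m = proj₁ (proj₂ (apply-sat D∈ [] X _ _ m))

    -- The operator D maps (k , z) with z = (x , y) to x for k = 0 and to y
    -- for k = 1, and it maps (k , 0) to 0: these are the projections.
    project : ℕ → D → D
    project k a = apply D∈ [] ∘ᴰ pairᴰ (constᴰ k) a

    hdᴰ tlᴰ : D → D
    hdᴰ = project 0
    tlᴰ = project 1

    val-project : ∀ k a X x {z} →
                  standard 𝒜 X (fn (apply D∈ [])) (pair (pair k (val a (X , x))) z) ≡ true →
                  val (project k a) (X , x) ≡ z
    val-project k a X x {z} e = val-∘-pair _ (constᴰ k) a X x
      (subst (λ n → standard 𝒜 X (fn (apply D∈ [])) (pair (pair n (val a (X , x))) z) ≡ true)
             (sym (val-const k (X , x))) e)

    val-hd : ∀ a p → val (hdᴰ a) p ≡ hd (val a p)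
    val-hd a (X , x) = val-project 0 a X x (at (val a (X , x)))
      where
      at : ∀ n → standard 𝒜 X (fn (apply D∈ [])) (pair (pair 0 n) (hd n)) ≡ true
      at zero    rewrite hd-zero = proj₂ (proj₂ (proj₂ (apply-sat D∈ [] X 0 0 0)))
      at (suc n) = subst (λ m → standard 𝒜 X (fn (apply D∈ [])) (pair (pair 0 m) (hd (suc n))) ≡ true)
                         (pair-unpair n) (proj₁ (apply-sat D∈ [] X _ _ 0))

    val-tl : ∀ a p → val (tlᴰ a) p ≡ tl (val a p)
    val-tl a (X , x) = val-project 1 a X x (at (val a (X , x)))
      where
      at : ∀ n → standard 𝒜 X (fn (apply D∈ [])) (pair (pair 1 n) (tl n)) ≡ true
      at zero    rewrite tl-zero = proj₂ (proj₂ (proj₂ (apply-sat D∈ [] X 0 0 1)))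
      at (suc n) = subst (λ m → standard 𝒜 X (fn (apply D∈ [])) (pair (pair 1 m) (tl (suc n))) ≡ true)
                         (pair-unpair n) (proj₁ (proj₂ (apply-sat D∈ [] X _ _ 0)))

    -- Bounded search: the least y below the value of b at x with
    -- g(y , x) = 1, or the value of b if there is none.
    search : D → D → D
    search b g = apply μ∈ (g ∷ []) ∘ᴰ pairᴰ b idᴰ

    search-finds : ∀ b g X x {y} → y < val b (X , x) → val g (X , pair y x) ≡ 1 →
                   val (search b g) (X , x) < val b (X , x) ×
                   val g (X , pair (val (search b g) (X , x)) x) ≡ 1
    search-finds b g X x {y} y<b gy = m<b , val-unique g X _
      -- The clause used here does not contain the variable y, which is set to 0.
      (proj₁ (proj₂ (proj₂ (apply-sat μ∈ (g ∷ []) X m 0 x (val b (X , x))))) (fm , m<b))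
      where
      m : ℕ
      m = val (search b g) (X , x)

      fm : standard 𝒜 X (fn (apply μ∈ (g ∷ []))) (pair (pair (val b (X , x)) x) m) ≡ true
      fm = subst₂ (λ u v → standard 𝒜 X (fn (apply μ∈ (g ∷ []))) (pair u v) ≡ true)
             (trans (val-pair b idᴰ (X , x)) (cong (pair _) (val-id X x)))
             (sym (val-∘ _ (pairᴰ b idᴰ) X x))
             (val-graph (apply μ∈ (g ∷ [])) X _)

      m≤y : m < y ⊎ m ≡ y
      m≤y = proj₁ (proj₂ (apply-sat μ∈ (g ∷ []) X m y x (val b (X , x))))
        (fm , y<b , subst (λ n → standard 𝒜 X (fn g) (pair (pair y x) n) ≡ true) gy (val-graph g X _))

      m<b : m < val b (X , x)
      m<b = ≤-<-trans ([ <⇒≤ , ≤-reflexive ]′ m≤y) y<b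

  -- Terms

  -- The numbers that an environment of derivations denotes at a point.
  at : ∀ {n} → Point → Vec D n → Vec ℕ n
  at p = map (λ d → val d p)

  infix 4 _at_⊨′_
  -- φ holds at the point (X , x), in the standard model over X.
  _at_⊨′_ : ∀ {n} → Vec D n → Point → L n → Set
  ρ at p ⊨′ φ = Sat (standard 𝒜 (proj₁ p)) (at p ρ) φ

  -- The value of a term under ρ, as a function of the point.
  termᴰ : ∀ {n} → Vec D n → Term n → D
  termᴰ ρ (var i)   = lookup ρ i
  termᴰ ρ 𝟎         = zeroᴰ
  termᴰ ρ (𝐒 t)     = sucᴰ (termᴰ ρ t)
  termᴰ ρ (𝐇 t)     = hdᴰ (termᴰ ρ t)
  termᴰ ρ (𝐓 t)     = tlᴰ (termᴰ ρ t)
  termᴰ ρ (t ⊕ s)   = termᴰ ρ t +ᴰ termᴰ ρ s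
  termᴰ ρ (t ⊗ s)   = termᴰ ρ t *ᴰ termᴰ ρ s
  termᴰ ρ ⟨ t , s ⟩ = pairᴰ (termᴰ ρ t) (termᴰ ρ s)

  val-term : ∀ {n} (ρ : Vec D n) t p → val (termᴰ ρ t) p ≡ eval (at p ρ) t
  val-term ρ (var i)   p = sym (lookup-map i _ ρ)
  val-term ρ 𝟎         p = val-zero p
  val-term ρ (𝐒 t)     p = trans (val-suc _ p) (cong suc (val-term ρ t p))
  val-term ρ (𝐇 t)     p = trans (val-hd _ p) (cong hd (val-term ρ t p))
  val-term ρ (𝐓 t)     p = trans (val-tl _ p) (cong tl (val-term ρ t p))
  val-term ρ (t ⊕ s)   p = trans (val-+ _ _ p) (cong₂ _+_ (val-term ρ t p) (val-term ρ s p))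
  val-term ρ (t ⊗ s)   p = trans (val-* _ _ p) (cong₂ _*_ (val-term ρ t p) (val-term ρ s p))
  val-term ρ ⟨ t , s ⟩ p = trans (val-pair _ _ p) (cong₂ pair (val-term ρ t p) (val-term ρ s p))

  eval-weaken : ∀ {n} (v : Vec ℕ n) a t → eval (a ∷ v) (renT suc t) ≡ eval v t
  eval-weaken v a (var i)   = refl
  eval-weaken v a 𝟎         = refl
  eval-weaken v a (𝐒 t)     = cong suc (eval-weaken v a t)
  eval-weaken v a (𝐇 t)     = cong hd (eval-weaken v a t)
  eval-weaken v a (𝐓 t)     = cong tl (eval-weaken v a t)
  eval-weaken v a (t ⊕ s)   = cong₂ _+_ (eval-weaken v a t) (eval-weaken v a s)
  eval-weaken v a (t ⊗ s)   = cong₂ _*_ (eval-weaken v a t) (eval-weaken v a s)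
  eval-weaken v a ⟨ t , s ⟩ = cong₂ pair (eval-weaken v a t) (eval-weaken v a s)

  -- Characteristic functions of bounded formulas

  opaque
    -- The connectives on truth values: ¬ A, A → B, A ∧ B and A ∨ B.

    notᴰ : D → D
    notᴰ a = ifᴰ a (constᴰ 1) zeroᴰ

    impᴰ andᴰ orᴰ : D → D → D
    impᴰ a b = ifᴰ a (constᴰ 1) b
    andᴰ a b = ifᴰ a zeroᴰ b
    orᴰ  a b = ifᴰ a b (constᴰ 1)

    decides-not : ∀ {A p} a → Decides A (val a p) → Decides (¬ A) (val (notᴰ a) p)
    decides-not {p = p} a A? rewrite val-if a (constᴰ 1) zeroᴰ p | val-const 1 p | val-zero p
      with val a p | A?
    ... | _ | holds x = fails (λ ¬x → ¬x x)
    ... | _ | fails x = holds x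

    decides-imp : ∀ {A B p} a b → Decides A (val a p) → Decides B (val b p) →
                  Decides (A → B) (val (impᴰ a b) p)
    decides-imp {p = p} a b A? B? rewrite val-if a (constᴰ 1) b p | val-const 1 p
      with val a p | A?
    ... | _ | holds x = Decides-⇔ (λ y _ → y) (λ f → f x) B?
    ... | _ | fails x = holds (λ y → ⊥-elim (x y))

    decides-and : ∀ {A B p} a b → Decides A (val a p) → Decides B (val b p) →
                  Decides (A × B) (val (andᴰ a b) p)
    decides-and {p = p} a b A? B? rewrite val-if a zeroᴰ b p | val-zero p
      with val a p | A?
    ... | _ | holds x = Decides-⇔ (x ,_) proj₂ B?
    ... | _ | fails x = fails (x ∘ proj₁)

    decides-or : ∀ {A B p} a b → Decides A (val a p) → Decides B (val b p) →
                 Decides (A ⊎ B) (val (orᴰ a b) p)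
    decides-or {p = p} a b A? B? rewrite val-if a b (constᴰ 1) p | val-const 1 p
      with val a p | A?
    ... | _ | holds x = holds (inj₁ x)
    ... | _ | fails x = Decides-⇔ inj₂ (λ { (inj₁ y) → ⊥-elim (x y) ; (inj₂ y) → y }) B?

    eqᴰ : D → D → D
    eqᴰ a b = andᴰ (notᴰ (a <ᴰ b)) (notᴰ (b <ᴰ a))

    val-eq : ∀ a b p → Decides (val a p ≡ val b p) (val (eqᴰ a b) p)
    val-eq a b p = Decides-⇔
      (λ { (a≮b , b≮a) → ≤-antisym (≮⇒≥ b≮a) (≮⇒≥ a≮b) })
      (λ e → <-irrefl e , <-irrefl (sym e))
      (decides-and (notᴰ (a <ᴰ b)) (notᴰ (b <ᴰ a))
        (decides-not (a <ᴰ b) (val-< a b p)) (decides-not (b <ᴰ a) (val-< b a p)))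

    -- A number z is in the graph f_d if z ≠ 0 and f_d(hd z) = tl z, and it
    -- is in X if the oracle function has the value 1 at z.
    memberᴰ : D → SetConst 𝒜 → D
    memberᴰ a X̂      = X⋆ ∘ᴰ a
    memberᴰ a (fn d) = ifᴰ a zeroᴰ (eqᴰ (d ∘ᴰ hdᴰ a) (tlᴰ a))

    val-member : ∀ a c X x → Decides (standard 𝒜 X c (val a (X , x)) ≡ true)
                                     (val (memberᴰ a c) (X , x))
    val-member a X̂ X x rewrite val-∘ X⋆ a X x with val a (X , x)
    ... | n with X n in e
    ...   | true  rewrite val-unique X⋆ X n (oracle-value X n e) = holds refl
    ...   | false rewrite val-unique X⋆ X n (oracle-value X n e) = fails λ ()
    val-member a (fn d) X x
      rewrite val-if a zeroᴰ (eqᴰ (d ∘ᴰ hdᴰ a) (tlᴰ a)) (X , x) | val-zero (X , x)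
      with val a (X , x) | val-hd a (X , x) | val-tl a (X , x)
    ... | zero  | _  | _  = fails (0∉graph d X)
    ... | suc n | eh | et = Decides-⇔ to from (val-eq (d ∘ᴰ hdᴰ a) (tlᴰ a) (X , x))
      where
      d-value : val (d ∘ᴰ hdᴰ a) (X , x) ≡ val d (X , hd (suc n))
      d-value = trans (val-∘ d (hdᴰ a) X x) (cong (λ m → val d (X , m)) eh)

      to : val (d ∘ᴰ hdᴰ a) (X , x) ≡ val (tlᴰ a) (X , x) → standard 𝒜 X (fn d) (suc n) ≡ true
      to e = trans (cong (standard 𝒜 X (fn d))
                     (trans (sym (pair-unpair n))
                            (cong (pair _) (trans (sym et) (trans (sym e) d-value)))))
                   (val-graph d X (hd (suc n)))

      from : standard 𝒜 X (fn d) (suc n) ≡ true → val (d ∘ᴰ hdᴰ a) (X , x) ≡ val (tlᴰ a) (X , x)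
      from e = trans d-value (trans
        (val-unique d X _ (trans (cong (standard 𝒜 X (fn d)) (pair-unpair n)) e)) (sym et))

  -- The environment ρ at x, extended by y, as functions of (y , x).
  extend : ∀ {n} → Vec D n → Vec D (suc n)
  extend ρ = hdᴰ idᴰ ∷ map (_∘ᴰ tlᴰ idᴰ) ρ

  at-extend : ∀ {n} (ρ : Vec D n) X y x → at (X , pair y x) (extend ρ) ≡ y ∷ at (X , x) ρ
  at-extend ρ X y x = cong₂ _∷_ hd≡y (tail ρ)
    where
    hd≡y : val (hdᴰ idᴰ) (X , pair y x) ≡ y
    hd≡y = trans (val-hd idᴰ (X , pair y x)) (trans (cong hd (val-id X _)) (hd-pair y x))

    tl≡x : val (tlᴰ idᴰ) (X , pair y x) ≡ x
    tl≡x = trans (val-tl idᴰ (X , pair y x)) (trans (cong tl (val-id X _)) (tl-pair y x))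

    tail : ∀ {m} (ρ : Vec D m) → at (X , pair y x) (map (_∘ᴰ tlᴰ idᴰ) ρ) ≡ at (X , x) ρ
    tail []      = refl
    tail (d ∷ ρ) = cong₂ _∷_
      (trans (val-∘ d (tlᴰ idᴰ) X _) (cong (λ m → val d (X , m)) tl≡x)) (tail ρ)

  mutual
    -- The characteristic function of a bounded formula, each bounded
    -- quantifier being evaluated at the result of a bounded search.
    char : ∀ {n} {φ : L n} → Bounded φ → Vec D n → D
    char (b≐ {t} {s}) ρ = eqᴰ (termᴰ ρ t) (termᴰ ρ s)
    char (b≺ {t} {s}) ρ = termᴰ ρ t <ᴰ termᴰ ρ s
    char (bε {t} {c}) ρ = memberᴰ (termᴰ ρ t) c
    char b⊥           ρ = zeroᴰ
    char (b⇒ bφ bψ)   ρ = impᴰ (char bφ ρ) (char bψ ρ)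
    char (b∧ bφ bψ)   ρ = andᴰ (char bφ ρ) (char bψ ρ)
    char (b∨ bφ bψ)   ρ = orᴰ (char bφ ρ) (char bψ ρ)
    char (b∀ t bφ)    ρ = impᴰ (critical∀ t bφ ρ <ᴰ termᴰ ρ t) (char bφ (critical∀ t bφ ρ ∷ ρ))
    char (b∃ t bφ)    ρ = andᴰ (critical∃ t bφ ρ <ᴰ termᴰ ρ t) (char bφ (critical∃ t bφ ρ ∷ ρ))

    -- The least counterexample to φ and the least example of φ below t at
    -- a point, as functions of the point; the value of t if there is none.
    critical∀ critical∃ : ∀ {n} t {φ : L (suc n)} → Bounded φ → Vec D n → D
    critical∀ t bφ ρ = search (termᴰ ρ t) (notᴰ (char bφ (extend ρ)))
    critical∃ t bφ ρ = search (termᴰ ρ t) (char bφ (extend ρ))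

  mutual
    decides : ∀ {n} {φ : L n} (bφ : Bounded φ) ρ p → Decides (ρ at p ⊨′ φ) (val (char bφ ρ) p)
    decides (b≐ {t} {s}) ρ p =
      Decides-≡ (cong₂ _≡_ (val-term ρ t p) (val-term ρ s p)) (val-eq _ _ p)
    decides (b≺ {t} {s}) ρ p =
      Decides-≡ (cong₂ _<_ (val-term ρ t p) (val-term ρ s p)) (val-< _ _ p)
    decides (bε {t} {c}) ρ p@(X , x) =
      Decides-≡ (cong (λ m → standard 𝒜 X c m ≡ true) (val-term ρ t p)) (val-member _ c X x)
    decides b⊥ ρ p rewrite val-zero p = fails id
    decides (b⇒ bφ bψ) ρ p = decides-imp _ _ (decides bφ ρ p) (decides bψ ρ p)
    decides (b∧ bφ bψ) ρ p = decides-and _ _ (decides bφ ρ p) (decides bψ ρ p)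
    decides (b∨ bφ bψ) ρ p = decides-or _ _ (decides bφ ρ p) (decides bψ ρ p)
    decides (b∀ t bφ) ρ p =
      Decides-⇔ (critical∀-spec t bφ ρ p) (λ f → f _) (decides-imp _ _
        (decides-bound t (critical∀ t bφ ρ) ρ p) (decides bφ (critical∀ t bφ ρ ∷ ρ) p))
    decides (b∃ t bφ) ρ p =
      Decides-⇔ (_ ,_) (critical∃-spec t bφ ρ p) (decides-and _ _
        (decides-bound t (critical∃ t bφ ρ) ρ p) (decides bφ (critical∃ t bφ ρ ∷ ρ) p))

    decides-bound : ∀ {n} t m (ρ : Vec D n) p →
      Decides ((m ∷ ρ) at p ⊨′ (v₀ ≺ renT suc t)) (val (m <ᴰ termᴰ ρ t) p)
    decides-bound t m ρ p = Decides-≡ (cong (val m p <_)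
      (trans (val-term ρ t p) (sym (eval-weaken (at p ρ) (val m p) t)))) (val-< m _ p)

    decides-extend : ∀ {n} {φ : L (suc n)} (bφ : Bounded φ) ρ X x y →
      Decides (Sat (standard 𝒜 X) (y ∷ at (X , x) ρ) φ) (val (char bφ (extend ρ)) (X , pair y x))
    decides-extend {φ = φ} bφ ρ X x y =
      Decides-≡ (cong (λ v → Sat (standard 𝒜 X) v φ) (at-extend ρ X y x))
            (decides bφ (extend ρ) (X , pair y x))

    -- A bounded quantifier is decided by its matrix at the critical value.
    critical∀-spec : ∀ {n} t {φ : L (suc n)} (bφ : Bounded φ) ρ p →
      (critical∀ t bφ ρ ∷ ρ) at p ⊨′ (v₀ ≺ renT suc t ⇒ φ) → ρ at p ⊨′ all≺ t φ
    critical∀-spec t bφ ρ p@(X , x) at-m y y<t with toDec (decides-extend bφ ρ X x y)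
    ... | yes h = h
    ... | no ¬h = ⊥-elim (decides-1⁻¹ (counter m) (proj₂ found) (at-m m<t))
      where
      counter : ∀ y → Decides (¬ Sat (standard 𝒜 X) (y ∷ at (X , x) ρ) _)
                              (val (notᴰ (char bφ (extend ρ))) (X , pair y x))
      counter y = decides-not (char bφ (extend ρ)) (decides-extend bφ ρ X x y)
      m = val (critical∀ t bφ ρ) p
      found = search-finds (termᴰ ρ t) _ X x
        (subst (y <_) (trans (eval-weaken (at p ρ) y t) (sym (val-term ρ t p))) y<t)
        (decides-1 (counter y) ¬h)
      m<t : m < eval (m ∷ at p ρ) (renT suc t)
      m<t = subst (m <_) (trans (val-term ρ t p) (sym (eval-weaken (at p ρ) m t))) (proj₁ found)

    critical∃-spec : ∀ {n} t {φ : L (suc n)} (bφ : Bounded φ) ρ p →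
      ρ at p ⊨′ ex≺ t φ → (critical∃ t bφ ρ ∷ ρ) at p ⊨′ (v₀ ≺ renT suc t ∧′ φ)
    critical∃-spec t bφ ρ p@(X , x) (y , y<t , h) =
      subst (m <_) (trans (val-term ρ t p) (sym (eval-weaken (at p ρ) m t))) (proj₁ found) ,
      decides-1⁻¹ (decides-extend bφ ρ X x m) (proj₂ found)
      where
      m = val (critical∃ t bφ ρ) p
      found = search-finds (termᴰ ρ t) _ X x
        (subst (y <_) (trans (eval-weaken (at p ρ) y t) (sym (val-term ρ t p))) y<t)
        (decides-1 (decides-extend bφ ρ X x y) h)

  -- Conditions and ideals

  -- A derivation is also regarded as the set of points where its
  -- function does not vanish; these sets are the forcing conditions.

  infix 4 _∋_ _⊆_
  _∋_ : D → Point → Set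
  b ∋ p = 0 < val b p

  _⊆_ : D → D → Set
  b ⊆ c = ∀ p → b ∋ p → c ∋ p

  ⊆-refl : ∀ {b} → b ⊆ b
  ⊆-refl p b∋p = b∋p

  ⊆-trans : ∀ {b c e} → b ⊆ c → c ⊆ e → b ⊆ e
  ⊆-trans b⊆c c⊆e p b∋p = c⊆e p (b⊆c p b∋p)

  opaque
    unfolding andᴰ

    andᴰ-⊆ : ∀ b c p → andᴰ b c ∋ p → (b ∋ p) × (c ∋ p)
    andᴰ-⊆ b c p h rewrite val-if b zeroᴰ c p | val-zero p with val b p | h
    ... | suc _ | c∋p = s≤s z≤n , c∋p

  -- An ideal of conditions: it is closed under subsets, contains the
  -- conditions without points, and contains b if it contains the two
  -- parts into which some condition c splits b.
  record Ideal : Set₁ where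
    field
      I      : D → Set
      shrink : ∀ {b c} → b ⊆ c → I c → I b
      empty  : ∀ {b} → (∀ p → ¬ b ∋ p) → I b
      split  : ∀ b c → I (andᴰ b c) → I (andᴰ b (notᴰ c)) → I b

    split-by : ∀ {n} {φ : L n} (bφ : Bounded φ) ρ b →
               (∀ c → c ⊆ b → (∀ p → c ∋ p → ρ at p ⊨′ φ) → I c) →
               (∀ c → c ⊆ b → (∀ p → c ∋ p → ¬ ρ at p ⊨′ φ) → I c) → I b
    split-by bφ ρ b h k = split b (char bφ ρ)
      (h _ (λ p → proj₁ ∘ andᴰ-⊆ b _ p)
           (λ p → decides-pos (decides bφ ρ p) ∘ proj₂ ∘ andᴰ-⊆ b _ p))
      (k _ (λ p → proj₁ ∘ andᴰ-⊆ b _ p)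
           (λ p → decides-pos (decides-not _ (decides bφ ρ p)) ∘ proj₂ ∘ andᴰ-⊆ b _ p))

  -- Forcing

  module Forcing (ideal : Ideal) where
    open Ideal ideal

    -- Every part of b on which φ fails everywhere is in the ideal.
    Locally : ∀ {n} → D → Vec D n → L n → Set
    Locally b ρ φ = ∀ c → c ⊆ b → (∀ p → c ∋ p → ¬ ρ at p ⊨′ φ) → I c

    -- b forces φ under ρ, where quantifiers range over derivations.
    -- Disjunction and existence carry a double negation, so that classical
    -- logic is sound.
    Forces : ∀ {n} → D → Vec D n → L n → Set
    Forces b ρ (t ≐ s)  = Locally b ρ (t ≐ s)
    Forces b ρ (t ≺ s)  = Locally b ρ (t ≺ s)
    Forces b ρ (t ε c)  = Locally b ρ (t ε c)
    Forces b ρ ⊥′       = I b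
    Forces b ρ (φ ⇒ ψ)  = ∀ c → c ⊆ b → Forces c ρ φ → Forces c ρ ψ
    Forces b ρ (φ ∧′ ψ) = Forces b ρ φ × Forces b ρ ψ
    Forces b ρ (φ ∨′ ψ) = ∀ c → c ⊆ b → (∀ e → e ⊆ c → Forces e ρ φ → I e) →
                                         (∀ e → e ⊆ c → Forces e ρ ψ → I e) → I c
    Forces b ρ (all φ)  = ∀ d → Forces b (d ∷ ρ) φ
    Forces b ρ (ex φ)   = ∀ c → c ⊆ b → (∀ d e → e ⊆ c → Forces e (d ∷ ρ) φ → I e) → I c

    mono : ∀ {n} (φ : L n) {ρ b c} → c ⊆ b → Forces b ρ φ → Forces c ρ φ
    mono (t ≐ s)  c⊆b h e e⊆c = h e (⊆-trans e⊆c c⊆b)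
    mono (t ≺ s)  c⊆b h e e⊆c = h e (⊆-trans e⊆c c⊆b)
    mono (t ε d)  c⊆b h e e⊆c = h e (⊆-trans e⊆c c⊆b)
    mono ⊥′       c⊆b h       = shrink c⊆b h
    mono (φ ⇒ ψ)  c⊆b h e e⊆c = h e (⊆-trans e⊆c c⊆b)
    mono (φ ∧′ ψ) c⊆b (h , k) = mono φ c⊆b h , mono ψ c⊆b k
    mono (φ ∨′ ψ) c⊆b h e e⊆c = h e (⊆-trans e⊆c c⊆b)
    mono (all φ)  c⊆b h d     = mono φ c⊆b (h d)
    mono (ex φ)   c⊆b h e e⊆c = h e (⊆-trans e⊆c c⊆b)

    -- If b forces ¬ ¬ φ, then b forces φ; the hypothesis is the forcing
    -- clause of ¬ ¬ φ written out.
    stable : ∀ {n} (φ : L n) {ρ b} →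
             (∀ c → c ⊆ b → (∀ e → e ⊆ c → Forces e ρ φ → I e) → I c) → Forces b ρ φ
    stable-atom : ∀ {n} (φ : L n) {ρ b} →
             (∀ c → c ⊆ b → (∀ e → e ⊆ c → Locally e ρ φ → I e) → I c) → Locally b ρ φ
    stable-atom φ h c c⊆b ¬φ = h c c⊆b λ e e⊆c k → k e ⊆-refl λ p e∋p → ¬φ p (e⊆c p e∋p)
    stable (t ≐ s)  h = stable-atom (t ≐ s) h
    stable (t ≺ s)  h = stable-atom (t ≺ s) h
    stable (t ε c)  h = stable-atom (t ε c) h
    stable ⊥′       h = h _ ⊆-refl λ _ _ → id
    stable (φ ⇒ ψ)  h c c⊆b f = stable ψ λ e e⊆c k →
      h e (⊆-trans e⊆c c⊆b) λ e′ e′⊆e g →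
        k e′ e′⊆e (g e′ ⊆-refl (mono φ (⊆-trans e′⊆e e⊆c) f))
    stable (φ ∧′ ψ) h =
      stable φ (λ c c⊆b k → h c c⊆b λ e e⊆c f → k e e⊆c (proj₁ f)) ,
      stable ψ (λ c c⊆b k → h c c⊆b λ e e⊆c f → k e e⊆c (proj₂ f))
    stable (φ ∨′ ψ) h c c⊆b k₁ k₂ = h c c⊆b λ e e⊆c f →
      f e ⊆-refl (λ e′ s → k₁ e′ (⊆-trans s e⊆c)) (λ e′ s → k₂ e′ (⊆-trans s e⊆c))
    stable (all φ)  h d = stable φ λ c c⊆b k → h c c⊆b λ e e⊆c f → k e e⊆c (f d)
    stable (ex φ)   h c c⊆b k = h c c⊆b λ e e⊆c f →
      f e ⊆-refl λ d e′ s → k d e′ (⊆-trans s e⊆c)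

    -- On b, the environment ρ′ denotes the values of the terms σ under ρ.
    -- Equality is only required at the points of b, which also covers the
    -- replacement of equals.
    record Agrees {m n} (b : D) (σ : Sub m n) (ρ : Vec D n) (ρ′ : Vec D m) : Set where
      constructor agrees
      field agree : ∀ p → b ∋ p → ∀ i → val (lookup ρ′ i) p ≡ eval (at p ρ) (σ i)
    open Agrees

    agrees-⊆ : ∀ {m n b c} {σ : Sub m n} {ρ ρ′} → c ⊆ b → Agrees b σ ρ ρ′ → Agrees c σ ρ ρ′
    agrees-⊆ c⊆b a = agrees λ p c∋p → agree a p (c⊆b p c∋p)

    agrees-lift : ∀ {m n b} {σ : Sub m n} {ρ ρ′} d → Agrees b σ ρ ρ′ →
                  Agrees b (liftS σ) (d ∷ ρ) (d ∷ ρ′)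
    agrees-lift {σ = σ} {ρ} d a = agrees λ where
      p b∋p zero    → refl
      p b∋p (suc i) → trans (agree a p b∋p i) (sym (eval-weaken (at p ρ) (val d p) (σ i)))

    eval-sub : ∀ {m n b} {σ : Sub m n} {ρ ρ′} → Agrees b σ ρ ρ′ → ∀ p → b ∋ p → ∀ t →
               eval (at p ρ) (subT σ t) ≡ eval (at p ρ′) t
    eval-sub {ρ′ = ρ′} a p q (var i) = trans (sym (agree a p q i)) (sym (lookup-map i _ ρ′))
    eval-sub a p q 𝟎         = refl
    eval-sub a p q (𝐒 t)     = cong suc (eval-sub a p q t)
    eval-sub a p q (𝐇 t)     = cong hd (eval-sub a p q t)
    eval-sub a p q (𝐓 t)     = cong tl (eval-sub a p q t)
    eval-sub a p q (t ⊕ s)   = cong₂ _+_ (eval-sub a p q t) (eval-sub a p q s)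
    eval-sub a p q (t ⊗ s)   = cong₂ _*_ (eval-sub a p q t) (eval-sub a p q s)
    eval-sub a p q ⟨ t , s ⟩ = cong₂ pair (eval-sub a p q t) (eval-sub a p q s)

    mutual
      sub→ : ∀ {m n} (φ : L m) {σ : Sub m n} {ρ ρ′ b} → Agrees b σ ρ ρ′ →
             Forces b ρ (sub σ φ) → Forces b ρ′ φ
      sub→ (t ≐ s) a h c c⊆b ¬φ = h c c⊆b λ p q →
        subst (¬_) (sym (cong₂ _≡_ (eval-sub a p (c⊆b p q) t) (eval-sub a p (c⊆b p q) s))) (¬φ p q)
      sub→ (t ≺ s) a h c c⊆b ¬φ = h c c⊆b λ p q →
        subst (¬_) (sym (cong₂ _<_ (eval-sub a p (c⊆b p q) t) (eval-sub a p (c⊆b p q) s))) (¬φ p q)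
      sub→ (t ε d) a h c c⊆b ¬φ = h c c⊆b λ p q →
        subst (λ n → ¬ standard 𝒜 (proj₁ p) d n ≡ true) (sym (eval-sub a p (c⊆b p q) t)) (¬φ p q)
      sub→ ⊥′       a h = h
      sub→ (φ ⇒ ψ)  a h c c⊆b f =
        sub→ ψ (agrees-⊆ c⊆b a) (h c c⊆b (sub← φ (agrees-⊆ c⊆b a) f))
      sub→ (φ ∧′ ψ) a (h , k) = sub→ φ a h , sub→ ψ a k
      sub→ (φ ∨′ ψ) a h c c⊆b k₁ k₂ = h c c⊆b
        (λ e s f → k₁ e s (sub→ φ (agrees-⊆ (⊆-trans s c⊆b) a) f))
        (λ e s f → k₂ e s (sub→ ψ (agrees-⊆ (⊆-trans s c⊆b) a) f))
      sub→ (all φ)  a h d = sub→ φ (agrees-lift d a) (h d)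
      sub→ (ex φ)   a h c c⊆b k = h c c⊆b λ d e s f →
        k d e s (sub→ φ (agrees-lift d (agrees-⊆ (⊆-trans s c⊆b) a)) f)

      sub← : ∀ {m n} (φ : L m) {σ : Sub m n} {ρ ρ′ b} → Agrees b σ ρ ρ′ →
             Forces b ρ′ φ → Forces b ρ (sub σ φ)
      sub← (t ≐ s) a h c c⊆b ¬φ = h c c⊆b λ p q →
        subst (¬_) (cong₂ _≡_ (eval-sub a p (c⊆b p q) t) (eval-sub a p (c⊆b p q) s)) (¬φ p q)
      sub← (t ≺ s) a h c c⊆b ¬φ = h c c⊆b λ p q →
        subst (¬_) (cong₂ _<_ (eval-sub a p (c⊆b p q) t) (eval-sub a p (c⊆b p q) s)) (¬φ p q)
      sub← (t ε d) a h c c⊆b ¬φ = h c c⊆b λ p q →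
        subst (λ n → ¬ standard 𝒜 (proj₁ p) d n ≡ true) (eval-sub a p (c⊆b p q) t) (¬φ p q)
      sub← ⊥′       a h = h
      sub← (φ ⇒ ψ)  a h c c⊆b f =
        sub← ψ (agrees-⊆ c⊆b a) (h c c⊆b (sub→ φ (agrees-⊆ c⊆b a) f))
      sub← (φ ∧′ ψ) a (h , k) = sub← φ a h , sub← ψ a k
      sub← (φ ∨′ ψ) a h c c⊆b k₁ k₂ = h c c⊆b
        (λ e s f → k₁ e s (sub← φ (agrees-⊆ (⊆-trans s c⊆b) a) f))
        (λ e s f → k₂ e s (sub← ψ (agrees-⊆ (⊆-trans s c⊆b) a) f))
      sub← (all φ)  a h d = sub← φ (agrees-lift d a) (h d)
      sub← (ex φ)   a h c c⊆b k = h c c⊆b λ d e s f →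
        k d e s (sub← φ (agrees-lift d (agrees-⊆ (⊆-trans s c⊆b) a)) f)

    true⇒locally : ∀ {n} (φ : L n) {ρ b} → (∀ p → b ∋ p → ρ at p ⊨′ φ) → Locally b ρ φ
    true⇒locally φ h c c⊆b ¬φ = empty λ p c∋p → ¬φ p c∋p (h p (c⊆b p c∋p))

    mutual
      -- Both directions for bounded formulas, by induction on the formula.
      -- A condition is split along the characteristic functions of the
      -- subformulas, and the critical values instantiate the quantifiers.
      forces⇒locally : ∀ {n} {φ : L n} → Bounded φ → ∀ {ρ b} → Forces b ρ φ → Locally b ρ φ
      forces⇒locally b≐ h = h
      forces⇒locally b≺ h = h
      forces⇒locally bε h = h
      forces⇒locally b⊥ h c c⊆b _ = shrink c⊆b h
      forces⇒locally (b⇒ {φ} bφ bψ) {ρ} h c c⊆b r =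
        forces⇒locally bψ (h c c⊆b (true⇒forces bφ φ-true)) c ⊆-refl λ p c∋p y → r p c∋p λ _ → y
        where
        φ-true : ∀ p → c ∋ p → ρ at p ⊨′ φ
        φ-true p c∋p with toDec (decides bφ ρ p)
        ... | yes x = x
        ... | no ¬x = ⊥-elim (r p c∋p (⊥-elim ∘ ¬x))
      forces⇒locally (b∧ bφ bψ) {ρ} (h , k) c c⊆b r = split-by bφ ρ c
        (λ e e⊆c x → forces⇒locally bψ k e (⊆-trans e⊆c c⊆b)
          λ p e∋p y → r p (e⊆c p e∋p) (x p e∋p , y))
        (λ e e⊆c ¬x → forces⇒locally bφ h e (⊆-trans e⊆c c⊆b) ¬x)
      forces⇒locally (b∨ bφ bψ) h c c⊆b r = h c c⊆b
        (λ e e⊆c f → forces⇒locally bφ f e ⊆-refl λ p e∋p x → r p (e⊆c p e∋p) (inj₁ x))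
        (λ e e⊆c f → forces⇒locally bψ f e ⊆-refl λ p e∋p x → r p (e⊆c p e∋p) (inj₂ x))
      forces⇒locally (b∀ t bφ) {ρ} h c c⊆b r =
        forces⇒locally bφ (h m c c⊆b (true⇒locally (v₀ ≺ renT suc t) m<t)) c ⊆-refl
          λ p c∋p y → r p c∋p (critical∀-spec t bφ ρ p (λ _ → y))
        where
        m = critical∀ t bφ ρ
        m<t : ∀ p → c ∋ p → (m ∷ ρ) at p ⊨′ (v₀ ≺ renT suc t)
        m<t p c∋p with toDec (decides-bound t m ρ p)
        ... | yes lt = lt
        ... | no nlt = ⊥-elim (r p c∋p (critical∀-spec t bφ ρ p (⊥-elim ∘ nlt)))
      forces⇒locally (b∃ t bφ) {ρ} h c c⊆b r = h c c⊆b λ d e e⊆c (f , g) →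
        split-by (bound t) (d ∷ ρ) e
          (λ e′ e′⊆e lt → forces⇒locally bφ g e′ e′⊆e
            λ p e′∋p y → r p (e⊆c p (e′⊆e p e′∋p)) (val d p , lt p e′∋p , y))
          (λ e′ e′⊆e nlt → f e′ e′⊆e nlt)

      locally⇒forces : ∀ {n} {φ : L n} → Bounded φ → ∀ {ρ b} → Locally b ρ φ → Forces b ρ φ
      locally⇒forces b≐ h = h
      locally⇒forces b≺ h = h
      locally⇒forces bε h = h
      locally⇒forces b⊥ h = h _ ⊆-refl λ _ _ → id
      locally⇒forces (b⇒ bφ bψ) {ρ} h c c⊆b f = locally⇒forces bψ λ e e⊆c ¬y → split-by bφ ρ e
        (λ e′ e′⊆e x → h e′ (⊆-trans e′⊆e (⊆-trans e⊆c c⊆b))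
          λ p e′∋p g → ¬y p (e′⊆e p e′∋p) (g (x p e′∋p)))
        (λ e′ e′⊆e ¬x → forces⇒locally bφ f e′ (⊆-trans e′⊆e e⊆c) ¬x)
      locally⇒forces (b∧ bφ bψ) h =
        locally⇒forces bφ (λ c c⊆b ¬x → h c c⊆b λ p c∋p → ¬x p c∋p ∘ proj₁) ,
        locally⇒forces bψ (λ c c⊆b ¬y → h c c⊆b λ p c∋p → ¬y p c∋p ∘ proj₂)
      locally⇒forces (b∨ bφ bψ) {ρ} h c c⊆b k₁ k₂ = split-by bφ ρ c
        (λ e e⊆c x → k₁ e e⊆c (true⇒forces bφ x))
        (λ e e⊆c ¬x → split-by bψ ρ e
          (λ e′ e′⊆e y → k₂ e′ (⊆-trans e′⊆e e⊆c) (true⇒forces bψ y))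
          (λ e′ e′⊆e ¬y → h e′ (⊆-trans e′⊆e (⊆-trans e⊆c c⊆b))
            λ p e′∋p → [ ¬x p (e′⊆e p e′∋p) , ¬y p e′∋p ]′))
      locally⇒forces (b∀ t bφ) {ρ} h d c c⊆b f = locally⇒forces bφ λ e e⊆c ¬y →
        split-by (bound t) (d ∷ ρ) e
          (λ e′ e′⊆e lt → h e′ (⊆-trans e′⊆e (⊆-trans e⊆c c⊆b))
            λ p e′∋p g → ¬y p (e′⊆e p e′∋p) (g (val d p) (lt p e′∋p)))
          (λ e′ e′⊆e nlt → f e′ (⊆-trans e′⊆e e⊆c) nlt)
      locally⇒forces (b∃ t bφ) {ρ} h c c⊆b k = split-by (b∃ t bφ) ρ c
        (λ e e⊆c x → k (critical∃ t bφ ρ) e e⊆c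
          (true⇒locally (v₀ ≺ renT suc t) (λ p → proj₁ ∘ critical∃-spec t bφ ρ p ∘ x p) ,
           true⇒forces bφ (λ p → proj₂ ∘ critical∃-spec t bφ ρ p ∘ x p)))
        (λ e e⊆c ¬x → h e (⊆-trans e⊆c c⊆b) ¬x)

      true⇒forces : ∀ {n} {φ : L n} → Bounded φ → ∀ {ρ b} →
                    (∀ p → b ∋ p → ρ at p ⊨′ φ) → Forces b ρ φ
      true⇒forces {φ = φ} bφ h = locally⇒forces bφ (true⇒locally φ h)

    -- Soundness

    -- φ is forced wherever it is true.
    record Transfers {n} (φ : L n) : Set where
      constructor transfers
      field transfer : ∀ ρ b → (∀ p → b ∋ p → ρ at p ⊨′ φ) → Forces b ρ φ
    open Transfers

    transfers-bounded : ∀ {n} {φ : L n} → Bounded φ → Transfers φ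
    transfers-bounded bφ = transfers λ ρ b → true⇒forces bφ

    transfers-all : ∀ {n} {φ : L (suc n)} → Transfers φ → Transfers (all φ)
    transfers-all tr = transfers λ ρ b h d → transfer tr (d ∷ ρ) b λ p b∋p → h p b∋p (val d p)

    transfers-∧ : ∀ {n} {φ ψ : L n} → Transfers φ → Transfers ψ → Transfers (φ ∧′ ψ)
    transfers-∧ trφ trψ = transfers λ ρ b h →
      transfer trφ ρ b (λ p → proj₁ ∘ h p) , transfer trψ ρ b (λ p → proj₂ ∘ h p)

    transfers-closure : ∀ n {φ : L n} → Transfers φ → Transfers (closure n φ)
    transfers-closure zero    tr = tr
    transfers-closure (suc n) tr = transfers-closure n (transfers-all tr)

    transfers-qf : ∀ n {φ : L n} → QuantifierFree φ → Transfers (closure n φ)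
    transfers-qf n {φ} qf = transfers-closure n (transfers-bounded (qf⇒bounded φ qf))

    transfers-BASIC : All Transfers BASIC
    transfers-BASIC =
        transfers-qf 1 _
      ∷ transfers-qf 2 _
      ∷ transfers-qf 1 _
      ∷ transfers-qf 2 _
      ∷ transfers-qf 1 _
      ∷ transfers-qf 2 _
      ∷ transfers-qf 1 _
      ∷ transfers-qf 2 _
      ∷ transfers-qf 2 _
      ∷ transfers-closure 1 (transfers-bounded (b⇒ b≺ (b∃ v₀ b≐)))
      ∷ transfers-qf 3 _
      ∷ transfers-qf 4 _
      ∷ transfers-closure 1 (transfers-bounded (b⇒ b≺ (b∃ v₀ (b∃ v₁ b≐))))
      ∷ transfers-qf 2 _
      ∷ transfers-qf 0 _
      ∷ transfers-qf 2 _
      ∷ transfers-qf 0 _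
      ∷ []

    -- Totality of f_d is witnessed at the individual e by the composition of
    -- d with e.
    transfers-𝓕 : ∀ d → Transfers (𝓕 (fn d))
    transfers-𝓕 d = transfers-∧ total (transfers-∧ (transfers-qf 3 _) (transfers-qf 0 _))
      where
      total : Transfers (all (ex (⟨ v₁ , v₀ ⟩ ε fn d)))
      total = transfers λ ρ b _ e c c⊆b k → k (d ∘ᴰ e) c ⊆-refl
        (true⇒forces (bε {t = ⟨ v₁ , v₀ ⟩} {fn d}) {d ∘ᴰ e ∷ e ∷ ρ} λ { p@(X , x) _ →
          subst (λ y → standard 𝒜 X (fn d) (pair (val e p) y) ≡ true)
                (sym (val-∘ d e X x)) (val-graph d X (val e p)) })

    transfers-opDef : ∀ i ds → Transfers (opDef 𝒜 i ds)
    transfers-opDef i ds = subst Transfers (sym (mapP-closure (opConsts 𝒜 i ds) numVars matrix))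
      (transfers-qf numVars (mapP-qf (opConsts 𝒜 i ds) matrix quantifierFree))
      where open Operator (operator i)

    transfers-axiom : ∀ {φ} → RA₁ 𝒜 φ → Transfers φ
    transfers-axiom (basic φ∈)  = All.lookup transfers-BASIC φ∈
    transfers-axiom oracleAx    = transfers-qf 1 _
    transfers-axiom oracle𝓕     = transfers-𝓕 X⋆
    transfers-axiom (opAx i ds) = transfers-opDef i ds
    transfers-axiom (op𝓕 i ds)  = transfers-𝓕 (op i ds)

    agrees-wk : ∀ {n} (ρ : Vec D n) d b → Agrees b (var ∘ suc) (d ∷ ρ) ρ
    agrees-wk ρ d b = agrees λ p _ i → sym (lookup-map i _ ρ)

    instantiate→ : ∀ {n} (φ : L (suc n)) t {ρ d b} → (∀ p → b ∋ p → val d p ≡ eval (at p ρ) t) →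
                   Forces b ρ (φ [ t ]) → Forces b (d ∷ ρ) φ
    instantiate→ φ t {ρ} e = sub→ φ (agrees λ where
      p b∋p zero    → e p b∋p
      p _   (suc i) → sym (lookup-map i _ ρ))

    instantiate← : ∀ {n} (φ : L (suc n)) t {ρ d b} → (∀ p → b ∋ p → val d p ≡ eval (at p ρ) t) →
                   Forces b (d ∷ ρ) φ → Forces b ρ (φ [ t ])
    instantiate← φ t {ρ} e = sub← φ (agrees λ where
      p b∋p zero    → e p b∋p
      p _   (suc i) → sym (lookup-map i _ ρ))

    forces-wk : ∀ {n} {ρ : Vec D n} {b} d (Γ : List (L n)) →
                All (Forces b ρ) Γ → All (Forces b (d ∷ ρ)) (List.map wk Γ)
    forces-wk {ρ = ρ} {b} d Γ h = All.map⁺ (All.map (λ {φ} → sub← φ (agrees-wk ρ d b)) h)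

    mono-all : ∀ {n} {ρ : Vec D n} {b c} {Γ : List (L n)} → c ⊆ b →
               All (Forces b ρ) Γ → All (Forces c ρ) Γ
    mono-all c⊆b = All.map (λ {φ} → mono φ c⊆b)

    sound : ∀ {n} {Γ : List (L n)} {φ} → Derives (RA₁ 𝒜) Γ φ → ∀ {ρ b} →
            All (Forces b ρ) Γ → Forces b ρ φ
    sound (axiom {φ} ax) {ρ} {b} h = sub← φ (agrees λ _ _ ())
      (transfer (transfers-axiom ax) [] b λ p _ → standard-isModel 𝒜 (proj₁ p) φ ax)
    sound (hyp φ∈)    h = All.lookup h φ∈
    sound (⇒I π₁)     h c c⊆b f = sound π₁ (f ∷ mono-all c⊆b h)
    sound (⇒E π₁ π₂)  h = sound π₁ h _ ⊆-refl (sound π₂ h)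
    sound (∧I π₁ π₂)  h = sound π₁ h , sound π₂ h
    sound (∧E₁ π₁)    h = proj₁ (sound π₁ h)
    sound (∧E₂ π₁)    h = proj₂ (sound π₁ h)
    sound (∨I₁ {φ} π₁) h c c⊆b k₁ k₂ = k₁ c ⊆-refl (mono φ c⊆b (sound π₁ h))
    sound (∨I₂ {ψ = ψ} π₁) h c c⊆b k₁ k₂ = k₂ c ⊆-refl (mono ψ c⊆b (sound π₁ h))
    sound (∨E {χ = χ} π₁ π₂ π₃) h = stable χ λ c c⊆b k → sound π₁ h c c⊆b
      (λ e e⊆c f → k e e⊆c (sound π₂ (f ∷ mono-all (⊆-trans e⊆c c⊆b) h)))
      (λ e e⊆c f → k e e⊆c (sound π₃ (f ∷ mono-all (⊆-trans e⊆c c⊆b) h)))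
    sound (raa {φ} π₁) h = stable φ λ c c⊆b k → sound π₁ (k ∷ mono-all c⊆b h)
    sound (∀I π₁)     h d = sound π₁ (forces-wk d _ h)
    sound (∀E {φ} π₁ t) {ρ} {b} h = instantiate← φ t (λ p _ → val-term ρ t p) (sound π₁ h (termᴰ ρ t))
    sound (∃I {φ} t π₁) {ρ} h c c⊆b k = k (termᴰ ρ t) c ⊆-refl
      (mono φ c⊆b (instantiate→ φ t (λ p _ → val-term ρ t p) (sound π₁ h)))
    sound (∃E {ψ = ψ} π₁ π₂) {ρ} h = stable ψ λ c c⊆b k → sound π₁ h c c⊆b
      λ d e e⊆c f → k e e⊆c (sub→ ψ (agrees-wk ρ d e)
        (sound π₂ (f ∷ forces-wk d _ (mono-all (⊆-trans e⊆c c⊆b) h))))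
    sound (=I t)      h c c⊆b ¬refl = empty λ p c∋p → ¬refl p c∋p refl
    -- On the part where t = s, the formulas φ[t] and φ[s] are
    -- forced alike; the part where t ≠ s is in the ideal.
    sound (=E {t} {s} φ π₁ π₂) {ρ} h = stable (φ [ s ]) λ c c⊆b k →
      split-by (b≐ {t = t} {s}) ρ c
        (λ e e⊆c t≡s → k e e⊆c (instantiate← φ s
          (λ p e∋p → trans (val-term ρ t p) (t≡s p e∋p))
          (instantiate→ φ t (λ p _ → val-term ρ t p)
            (mono (φ [ t ]) (⊆-trans e⊆c c⊆b) (sound π₂ h)))))
        (λ e e⊆c t≢s → sound π₁ h e (⊆-trans e⊆c c⊆b) t≢s)

    forces-theorem : ∀ {φ} → RA₁ 𝒜 ⊢ φ → ∀ b → Forces b [] φ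
    forces-theorem π₁ _ = sound π₁ []

    -- To show that a condition forcing a Σ₁ formula is in the ideal, it
    -- may be assumed that the formula is true at all points of the condition:
    -- the witnesses of the existential quantifiers are given as derivations.
    Σ₁-witness : ∀ {n} {φ : L n} → Σ₁ φ → ∀ {ρ b} → Forces b ρ φ →
                 (∀ c → c ⊆ b → (∀ p → c ∋ p → ρ at p ⊨′ φ) → I c) → I b
    Σ₁-witness (bounded bφ) {ρ} {b} f k = split-by bφ ρ b k (forces⇒locally bφ f)
    Σ₁-witness (exists σφ) f k = f _ ⊆-refl λ d e e⊆b g →
      Σ₁-witness σφ g λ c c⊆e h → k c (⊆-trans c⊆e e⊆b) λ p c∋p → val d p , h p c∋p

  -- The theorem

  -- Every condition is covered by its parts inside and outside of c.
  opaque
    unfolding andᴰ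

    andᴰ-cover : ∀ b c p → b ∋ p →
                 ((∃ λ k → val c p ≡ suc k) × andᴰ b c ∋ p) ⊎
                 (val c p ≡ 0 × andᴰ b (notᴰ c) ∋ p)
    andᴰ-cover b c p b∋p
      rewrite val-if b zeroᴰ c p | val-if b zeroᴰ (notᴰ c) p | val-if c (constᴰ 1) zeroᴰ p
            | val-const 1 p
      with val b p | b∋p | val c p
    ... | suc _ | _ | zero  = inj₂ (refl , s≤s z≤n)
    ... | suc _ | _ | suc k = inj₁ ((k , refl) , s≤s z≤n)

  -- The set of all points
  fullᴰ : D
  fullᴰ = constᴰ 1

  full∋ : ∀ p → fullᴰ ∋ p
  full∋ p = subst (0 <_) (sym (val-const 1 p)) (s≤s z≤n)

  -- The ideal of the conditions on which a derivation d solves φ(x , y)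
  -- for y.  It is closed under unions by definition by cases.
  solvable : L 2 → Ideal
  solvable φ = record
    { I      = Solved
    ; shrink = λ { b⊆c (d , h) → d , λ p → h p ∘ b⊆c p }
    ; empty  = λ b∌ → zeroᴰ , λ p b∋p → ⊥-elim (b∌ p b∋p)
    ; split  = split
    }
    where
    Solved : D → Set
    Solved b = ∃ λ d → ∀ p → b ∋ p → (d ∷ idᴰ ∷ []) at p ⊨′ φ

    split : ∀ b c → Solved (andᴰ b c) → Solved (andᴰ b (notᴰ c)) → Solved b
    split b c (d , h) (e , k) = ifᴰ c e d , λ p b∋p →
      subst (λ y → Sat (standard 𝒜 (proj₁ p)) (y ∷ val idᴰ p ∷ []) φ)
            (sym (val-if c e d p)) (cases p b∋p)
      where
      cases : ∀ p → b ∋ p → Sat (standard 𝒜 (proj₁ p))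
                (ifZ (val c p) (val e p) (val d p) ∷ val idᴰ p ∷ []) φ
      cases p b∋p with andᴰ-cover b c p b∋p
      ... | inj₁ ((_ , c≡) , in-c)  rewrite c≡ = h p in-c
      ... | inj₂ (c≡ , out-c)       rewrite c≡ = k p out-c

  provable⇒solution : ∀ {φ} → Σ₁ φ → RA₁ 𝒜 ⊢ all (∃!′ φ) →
                      ∃ λ d → ∀ p → (d ∷ idᴰ ∷ []) at p ⊨′ φ
  provable⇒solution {φ} σφ π₁ = proj₁ solution , λ p → proj₂ solution p (full∋ p)
    where
    open Ideal (solvable φ)
    open Forcing (solvable φ)
    solution : I fullᴰ
    solution = forces-theorem π₁ fullᴰ idᴰ fullᴰ ⊆-refl λ d e _ f →
      Σ₁-witness σφ (proj₁ f) λ c _ h → d , h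

  -- Constructively this is no consequence of the soundness of natural
  -- deduction for the standard model, where reductio ad absurdum may fail;
  -- forcing with an ideal that concentrates on one point replaces it.
  provable⇒unique : ∀ {φ} → Σ₁ φ → RA₁ 𝒜 ⊢ all (∃!′ φ) → ∀ X x y z →
                    Sat (standard 𝒜 X) (y ∷ x ∷ []) φ → Sat (standard 𝒜 X) (z ∷ x ∷ []) φ → y ≡ z
  provable⇒unique {φ} σφ π₁ X x y z φy φz =
    forces-theorem π₁ fullᴰ idᴰ fullᴰ ⊆-refl
      (λ d e _ f → unique refl refl d e (proj₂ f)) (full∋ (X , x))
    where
    p₀ : Point
    p₀ = X , x

    atPoint : Ideal
    atPoint = record
      { I      = λ b → b ∋ p₀ → y ≡ z
      ; shrink = λ b⊆c h → h ∘ b⊆c p₀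
      ; empty  = λ b∌ b∋p → ⊥-elim (b∌ p₀ b∋p)
      ; split  = λ b c h k b∋p → [ h ∘ proj₂ , k ∘ proj₂ ]′ (andᴰ-cover b c p₀ b∋p)
      }
    open Ideal atPoint
    open Forcing atPoint

    -- A Σ₁ formula that is true at p₀ is forced, with constants as
    -- witnesses.
    true⇒forcesΣ : ∀ {n} {φ : L n} → Σ₁ φ → ∀ {ρ b} → ρ at p₀ ⊨′ φ → Forces b ρ φ
    true⇒forcesΣ {φ = φ} (bounded bφ) {ρ} h = locally⇒forces bφ λ c _ ¬φ c∋p₀ → ⊥-elim (¬φ p₀ c∋p₀ h)
    true⇒forcesΣ (exists {φ} σφ) {ρ} (a , h) c _ k = k (constᴰ a) c ⊆-refl
      (true⇒forcesΣ σφ (subst (λ a → Sat (standard 𝒜 X) (a ∷ at p₀ ρ) φ) (sym (val-const a p₀)) h))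

    forces-at : ∀ y {b} → Sat (standard 𝒜 X) (y ∷ x ∷ []) φ → Forces b (constᴰ y ∷ idᴰ ∷ []) φ
    forces-at y h = true⇒forcesΣ σφ
      (subst₂ (λ y x → Sat (standard 𝒜 X) (y ∷ x ∷ []) φ)
              (sym (val-const y p₀)) (sym (val-id X x)) h)

    -- Stated for the substitution σ that maps φ(x , y) to φ(x , y′); both
    -- y and z are equal to the individual d on e.
    unique : ∀ {σ : Sub 2 3} → σ zero ≡ v₀ → σ (suc zero) ≡ v₂ → ∀ d e →
             Forces e (d ∷ idᴰ ∷ []) (all (sub σ φ ⇒ v₀ ≐ v₁)) → I e
    unique {σ} σ₀ σ₁ d e only = split-by (b≐ {t = v₀} {v₁}) (constᴰ y ∷ d ∷ []) e
      (λ c c⊆e y≡ → split-by (b≐ {t = v₀} {v₁}) (constᴰ z ∷ d ∷ []) c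
        (λ c′ c′⊆c z≡ c′∋p₀ → trans (sym (val-const y p₀)) (trans (y≡ p₀ (c′⊆c p₀ c′∋p₀))
          (trans (sym (z≡ p₀ c′∋p₀)) (val-const z p₀))))
        (λ c′ c′⊆c z≢ → equals z φz c′ (⊆-trans c′⊆c c⊆e) z≢))
      (λ c c⊆e y≢ → equals y φy c c⊆e y≢)
      where
      equals : ∀ y → Sat (standard 𝒜 X) (y ∷ x ∷ []) φ →
               Locally e (constᴰ y ∷ d ∷ idᴰ ∷ []) (v₀ ≐ v₁)
      equals y φy = only (constᴰ y) e ⊆-refl (sub← φ (agrees agree-σ) (forces-at y φy))
        where
        agree-σ : ∀ p → e ∋ p → ∀ i → val (lookup (constᴰ y ∷ idᴰ ∷ []) i) p ≡
                                      eval (at p (constᴰ y ∷ d ∷ idᴰ ∷ [])) (σ i)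
        agree-σ p _ zero       rewrite σ₀ = refl
        agree-σ p _ (suc zero) rewrite σ₁ = refl

  provablyTotal⇒computes : ∀ f → ProvablyTotal 𝒜 f → ∃ λ d → Computes 𝒜 d f
  provablyTotal⇒computes f (φ , σφ , π₁ , φf) with provable⇒solution σφ π₁
  ... | d , φd = d , λ X x → subst (λ y → standard 𝒜 X (fn d) (pair x y) ≡ true)
    (provable⇒unique σφ π₁ X x _ _
      (subst (λ n → Sat (standard 𝒜 X) (val d (X , x) ∷ n ∷ []) φ) (val-id X x) (φd (X , x)))
      (φf X x))
    (val-graph d X x)

  𝓕-axiom : ∀ d → RA₁ 𝒜 (𝓕 (fn d))
  𝓕-axiom X⋆        = oracle𝓕
  𝓕-axiom (op i ds) = op𝓕 i ds

  computes⇒provablyTotal : ∀ d f → Computes 𝒜 d f → ProvablyTotal 𝒜 f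
  computes⇒provablyTotal d f comp = φ , bounded bε , ∀I proof , comp
    where
    φ : L 2
    φ = ⟨ v₁ , v₀ ⟩ ε fn d

    𝓕d : ∀ {n} {Γ : List (L n)} → Derives (RA₁ 𝒜) Γ (embed (𝓕 (fn d)))
    𝓕d = axiom (𝓕-axiom d)

    proof : Derives (RA₁ 𝒜) [] (∃!′ φ)
    proof = ∃E (∀E (∧E₁ 𝓕d) v₀)
      (∃I v₀ (∧I (hyp (here refl))
        (∀I (⇒I (⇒E (∀E (∀E (∀E (∧E₁ (∧E₂ 𝓕d)) v₁) v₀) v₂)
          (∧I (hyp (here refl)) (hyp (there (here refl)))))))))

theorem8p3 : (𝒜 : AlgebraClass) (f : ℕ → Subset → ℕ) →
    ProvablyTotal 𝒜 f ⇔ (∃ λ (d : Derivation 𝒜) → Computes 𝒜 d f)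
theorem8p3 𝒜 f = mk⇔ (provablyTotal⇒computes f) λ { (d , comp) → computes⇒provablyTotal d f comp }
  where open Algebra 𝒜
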